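{- Let $A=\{a_s(n_s)\}_{s=1}^k$ and $B=\{b_t(m_t)\}_{t=1}^l$ be two finite systems of residue classes, where $n_s,m_t$ are positive integers, $a_s,b_t$ are integers with $0\leqslant a_s<n_s$ for $s=1,\ldots,k$ and $0\leqslant b_t<m_t$ for $t=1,\ldots,l$. Let $$S(n_1,\ldots,n_k,m_1,\ldots,m_l)=\left\{\tfrac{r}{n_s}: 0\leqslant r<n_s,\ 1\leqslant s\leqslant k\right\}\cup\left\{\tfrac{r}{m_t}: 0\leqslant r<m_t,\ 1\leqslant t\leqslant l\right\}\subseteq\mathbb{Q},$$ let $p$ be a prime with $p>|S(n_1,\ldots,n_k,m_1,\ldots,m_l)|$, and let $\zeta_p$ be a primitive $p$th root of unity. Then $A$ and $B$ are covering equivalent (i.e. $w_A(x)=w_B(x)$ for all $x\in\mathbb{Z}$) if and only if $$\sum_{s=1}^k\frac{\zeta_p^{a_s}}{1-\zeta_p^{n_s}}=\sum_{t=1}^l\frac{\zeta_p^{b_t}}{1-\zeta_p^{m_t}}.$$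
   Context: For a positive integer $n$ and $0\leqslant a<n$, $a(n)$ denotes the residue class $\{x\in\mathbb{Z}: x\equiv a \pmod n\}$. For a finite system $A=\{a_s(n_s)\}_{s=1}^k$ (a list, repetitions allowed), its covering function $w_A:\mathbb{Z}\to\{0,1,2,\ldots\}$ is $w_A(x)=|\{1\leqslant s\leqslant k: x\equiv a_s \pmod{n_s}\}|$; the covering function of the empty system is identically zero. Two systems are covering equivalent if they have the same covering function. -}

module Defs where

open import Level using (Level; suc; _⊔_)
open import Data.Nat as ℕ using (ℕ; zero; _<_)
open import Data.Nat.Divisibility using (_∣?_)
open import Data.Integer as ℤ using (ℤ; +_; ∣_∣)
open import Data.Rational as ℚ using (ℚ)
open import Data.Product using (_×_; _,_; proj₁; proj₂)
open import Data.List using (List; []; _∷_; length; filter; map; concatMap; upTo; deduplicate; _++_; foldr)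
open import Algebra.Bundles using (CommutativeRing; Semiring)
open import Relation.Nullary using (¬_)
open import Relation.Binary.PropositionalEquality using (_≡_)

-- A residue class a(n) is encoded as the pair (a , n) of naturals,
-- with the side condition 0 ≤ a < n (so n ≥ 1) imposed in the theorem.
ResidueClass : Set
ResidueClass = ℕ × ℕ

System : Set
System = List ResidueClass

-- Covering function: w_A(x) = #{ s : x ≡ a_s (mod n_s) }.
-- x ≡ a (mod n) means n ∣ (x - a) in ℤ, which by definition of
-- Data.Integer.Divisibility._∣_ is  n ∣ ∣ x - a ∣  in ℕ.
covering : System → ℤ → ℕ
covering A x = length (filter (λ c → proj₂ c ∣? ∣ x ℤ.- (+ proj₁ c) ∣) A)

CoveringEquivalent : System → System → Set
CoveringEquivalent A B = ∀ (x : ℤ) → covering A x ≡ covering B x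

-- The fractions r/n for 0 ≤ r < n (empty for n = 0, which is excluded anyway).
fractions : ℕ → List ℚ
fractions zero = []
fractions (ℕ.suc n) = map (λ r → (+ r) ℚ./ ℕ.suc n) (upTo (ℕ.suc n))

moduli : System → List ℕ
moduli = map proj₂

cardS : System → System → ℕ
cardS A B = length (deduplicate ℚ._≟_ (concatMap fractions (moduli A ++ moduli B)))

record Field (c ℓ : Level) : Set (suc (c ⊔ ℓ)) where
  field
    commutativeRing : CommutativeRing c ℓ
  open CommutativeRing commutativeRing public
  field
    _⁻¹      : Carrier → Carrier
    1≉0      : ¬ (1# ≈ 0#)
    inverseʳ : ∀ x → ¬ (x ≈ 0#) → (x * (x ⁻¹)) ≈ 1#
  open import Algebra.Definitions.RawSemiring (Semiring.rawSemiring semiring) public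
    using (_^_) renaming (_×_ to _·_)

module _ {c ℓ} (F : Field c ℓ) where
  open Field F

  CharZero : Set ℓ
  CharZero = ∀ (n : ℕ) → (n · 1#) ≈ 0# → n ≡ 0

  PrimitiveRoot : ℕ → Carrier → Set ℓ
  PrimitiveRoot p ζ = (ζ ^ p) ≈ 1# × (∀ j → 0 < j → j < p → ¬ ((ζ ^ j) ≈ 1#))

  cotSum : Carrier → System → Carrier
  cotSum ζ = foldr (λ c acc → ((ζ ^ proj₁ c) * ((1# - (ζ ^ proj₂ c)) ⁻¹)) + acc) 0#

{-# OPTIONS --safe #-}
module Submission where

open import Defs
open import Algebra.Bundles using (CommutativeRing; Semiring)
open import Data.Empty using (⊥-elim)
open import Data.Fin.Base using (Fin; zero; suc; toℕ; fromℕ; fromℕ<; inject₁; punchIn)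
import Data.Fin.Properties as Fin
open import Data.Integer.Base as ℤ using (ℤ; +_; -[1+_]; ∣_∣)
import Data.Integer.DivMod as ℤ
open import Data.Integer.Divisibility.Signed as ℤ using (divides) renaming (_∣_ to _∣ℤ_)
import Data.Integer.Properties as ℤ
open import Data.Integer.Tactic.RingSolver using (solve-∀)
open import Data.List.Base using (List; []; _∷_; _++_; length; lookup; filter; map; concatMap; upTo; applyUpTo; deduplicate)
open import Data.List.Membership.Propositional using (_∈_)
open import Data.List.Membership.Propositional.Properties
  using (∈-lookup; ∈-map⁺; ∈-map⁻; ∈-upTo⁺; ∈-upTo⁻; ∈-filter⁻; ∈-concatMap⁺; ∈-deduplicate⁺; ∈-++⁺ˡ; ∈-++⁺ʳ)
open import Data.List.Properties using (length-map; length-upTo)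
open import Data.List.Relation.Unary.All as All using (All; []; _∷_)
import Data.List.Relation.Unary.All.Properties as All
open import Data.List.Relation.Unary.AllPairs using ([]; _∷_)
open import Data.List.Relation.Unary.Any as Any using (Any; here; there)
import Data.List.Relation.Unary.Any.Properties as Any
open import Data.List.Relation.Unary.Unique.Propositional using (Unique)
import Data.List.Relation.Unary.Unique.Propositional.Properties as Unique
import Data.Maybe.Base as Maybe
open import Data.Nat using (ℕ; _<_)
open import Data.Nat.Base as ℕ using (zero; suc; _≤_; _∸_; _!; z≤n; s≤s)
open import Data.Nat.Combinatorics using (_C_; nCk≡n!/k![n-k]!; k![n∸k]!∣n!; nCn≡1; nC1≡n)
import Data.Nat.Divisibility as ℕ
import Data.Nat.DivMod as ℕ
open import Data.Nat.GCD
  using (gcd; gcd-comm; gcd-assoc; gcd[m,n]∣m; gcd[m,n]∣n; gcd-greatest; gcd-GCD; module Bézout; c*gcd[m,n]≡gcd[cm,cn])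
open import Data.Nat.LCM using (lcm; lcm-least; m∣lcm[m,n]; n∣lcm[m,n]; gcd*lcm)
open import Data.Nat.ListAction using (product)
open import Data.Nat.ListAction.Properties using (∈⇒∣product; product≢0)
open import Data.Nat.Primality using (Prime; euclidsLemma; prime⇒nonZero; prime⇒nonTrivial; ¬prime[0]; ¬prime[1])
import Data.Nat.Properties as ℕ
open import Data.Product using (_×_; _,_; ∃; proj₁; proj₂)
open import Data.Rational.Base as ℚ using (ℚ)
import Data.Rational.Properties as ℚ
import Data.Rational.Unnormalised.Base as ℚᵘ
open import Data.Sum using (_⊎_; inj₁; inj₂; [_,_]′)
open import Data.Vec.Functional using (insertAt) renaming (_∷_ to _∷ᵥ_)
open import Data.Vec.Functional.Properties using (insertAt-lookup; insertAt-punchIn)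
open import Function.Base using (_∘_; id)
open import Function.Bundles using (_⇔_; mk⇔)
open import Level using (_⊔_)
open import Relation.Binary.PropositionalEquality as ≡ using (_≡_; _≢_)
open import Relation.Nullary using (Dec; yes; no; ¬_)
open import Relation.Nullary.Decidable using (decidable-stable; dec⇒maybe)
open import Relation.Nullary.Negation using (contradiction)
open import Relation.Unary using (Decidable)

-- Let N be the product of the moduli and f = w_A - w_B. Multiplying by 1 - ζ^N turns the difference of
-- the two sums into Σ_{x<N} f(x) ζ^x, which gives one direction at once. For the other, f lies in the
-- span of the functions periodic modulo one of the moduli. This space is the image of a projection
-- built from averaging operators by inclusion–exclusion, and the trace of that projection is |S|. As
-- |S| < p, the p functions f(x), …, f(x + p - 1) are linearly dependent over ℤ: some nonzero polynomial
-- d of degree at most p - 1 makes d(z) Σ f(x) z^x a polynomial of degree at most p - 2. It vanishes at ζ,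
-- and 1, ζ, …, ζ^(p-2) are linearly independent over ℤ, so it is zero and f = 0.
--
-- The independence is proved with π = ζ - 1: p = ε π^(p-1) with ε in ℤ[ζ], and an integer divisible by π
-- in ℤ[ζ] is divisible by p, so a relation has all its coefficients divisible by every power of p.

-- Over ℂ the space of functions in question is spanned by the characters x ↦ exp(2πi θ x) with θ in
-- S, which is where the number |S| comes from. These characters are not at hand: F contains ζ, but
-- perhaps no root of unity of order n_s. Moreover the dependence must have integer coefficients,
-- since the independence that finishes the proof holds over ℤ. So the dimension is read off from a
-- trace, and all linear algebra is done over ℤ with denominators cleared. The series Σ f(x) z^x has
-- no value at ζ. Because f has period N, the expression Σ_{x<N} f(x) ζ^x / (1 - ζ^N) takes its
-- place, which makes sense because p does not divide N; truncations of the series are compared with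
-- it exactly. Equality in F is not assumed decidable. Every case distinction is therefore made on
-- integers, and the independence of the powers of ζ is obtained from divisibility in ℤ, with no
-- minimal polynomial and no norm.

𝟙 : ∀ {a} {P : Set a} → Dec P → ℤ
𝟙 (yes _) = + 1
𝟙 (no _)  = + 0

𝟙-yes : ∀ {a} {P : Set a} (P? : Dec P) → P → 𝟙 P? ≡ + 1
𝟙-yes (yes _) _ = ≡.refl
𝟙-yes (no ¬P) P = contradiction P ¬P

𝟙-no : ∀ {a} {P : Set a} (P? : Dec P) → ¬ P → 𝟙 P? ≡ + 0
𝟙-no (yes P) ¬P = contradiction P ¬P
𝟙-no (no _)  _  = ≡.refl

-- The image of ℤ in a commutative ring

module IntegerImage {c ℓ} (R : CommutativeRing c ℓ) where
  open CommutativeRing R hiding (zero)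
  open import Algebra.Properties.Ring ring using (-‿distribˡ-*; -‿distribʳ-*; -‿involutive; -0#≈0#; -‿+-comm; xyx⁻¹≈y)
  open import Algebra.Properties.Semiring.Mult semiring renaming (_×_ to _·_)
  open import Relation.Binary.Reasoning.Setoid setoid

  ι : ℤ → Carrier
  ι (+ n)    = n · 1#
  ι -[1+ n ] = - (suc n · 1#)

  ι-neg : ∀ i → ι (ℤ.- i) ≈ - ι i
  ι-neg (+ zero)   = sym -0#≈0#
  ι-neg (+ suc n)  = refl
  ι-neg -[1+ n ]   = sym (-‿involutive _)

  ι-⊖ : ∀ m n → ι (m ℤ.⊖ n) ≈ m · 1# - n · 1#
  ι-⊖ m zero = sym (trans (+-congˡ -0#≈0#) (+-identityʳ _))
  ι-⊖ zero (suc n) = sym (+-identityˡ _)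
  ι-⊖ (suc m) (suc n) = begin
    ι (suc m ℤ.⊖ suc n)               ≡⟨ ≡.cong ι (ℤ.[1+m]⊖[1+n]≡m⊖n m n) ⟩
    ι (m ℤ.⊖ n)                       ≈⟨ ι-⊖ m n ⟩
    m · 1# - n · 1#                   ≈⟨ +-congʳ (xyx⁻¹≈y 1# _) ⟨
    1# + m · 1# - 1# - n · 1#         ≈⟨ +-assoc _ _ _ ⟩
    1# + m · 1# + (- 1# - n · 1#)     ≈⟨ +-congˡ (-‿+-comm 1# _) ⟩
    suc m · 1# - suc n · 1#           ∎

  ι-+ : ∀ i j → ι (i ℤ.+ j) ≈ ι i + ι j
  ι-+ (+ m) (+ n) = ×-homo-+ 1# m n
  ι-+ (+ m) -[1+ n ] = ι-⊖ m (suc n)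
  ι-+ -[1+ m ] (+ n) = trans (ι-⊖ n (suc m)) (+-comm _ _)
  ι-+ -[1+ m ] -[1+ n ] = begin
    - (suc (suc (m ℕ.+ n)) · 1#)   ≡⟨ ≡.cong (λ k → - (suc k · 1#)) (ℕ.+-suc m n) ⟨
    - ((suc m ℕ.+ suc n) · 1#)     ≈⟨ -‿cong (×-homo-+ 1# (suc m) (suc n)) ⟩
    - (suc m · 1# + suc n · 1#)    ≈⟨ -‿+-comm _ _ ⟨
    - (suc m · 1#) - suc n · 1#    ∎

  ι-*-+ : ∀ m j → ι (+ m ℤ.* j) ≈ ι (+ m) * ι j
  ι-*-+ m (+ n) = trans (reflexive (≡.cong ι (≡.sym (ℤ.pos-* m n)))) (×1-homo-* m n)
  ι-*-+ m -[1+ n ] = begin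
    ι (+ m ℤ.* ℤ.- (+ suc n))     ≡⟨ ≡.cong ι (ℤ.neg-distribʳ-* (+ m) (+ suc n)) ⟨
    ι (ℤ.- (+ m ℤ.* + suc n))     ≈⟨ ι-neg (+ m ℤ.* + suc n) ⟩
    - ι (+ m ℤ.* + suc n)         ≈⟨ -‿cong (ι-*-+ m (+ suc n)) ⟩
    - (ι (+ m) * ι (+ suc n))     ≈⟨ -‿distribʳ-* _ _ ⟩
    ι (+ m) * ι -[1+ n ]          ∎

  ι-* : ∀ i j → ι (i ℤ.* j) ≈ ι i * ι j
  ι-* (+ m) j = ι-*-+ m j
  ι-* -[1+ m ] j = begin
    ι (ℤ.- (+ suc m) ℤ.* j)       ≡⟨ ≡.cong ι (ℤ.neg-distribˡ-* (+ suc m) j) ⟨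
    ι (ℤ.- (+ suc m ℤ.* j))       ≈⟨ ι-neg (+ suc m ℤ.* j) ⟩
    - ι (+ suc m ℤ.* j)           ≈⟨ -‿cong (ι-*-+ (suc m) j) ⟩
    - (ι (+ suc m) * ι j)         ≈⟨ -‿distribˡ-* _ _ ⟩
    ι -[1+ m ] * ι j              ∎

  ι-1 : ι (+ 1) ≈ 1#
  ι-1 = +-identityʳ 1#

  open import Algebra.Solver.Ring.AlmostCommutativeRing
    using (fromCommutativeRing; _-Raw-AlmostCommutative⟶_)

  ι-morphism : ℤ.+-*-rawRing -Raw-AlmostCommutative⟶ fromCommutativeRing R
  ι-morphism = record
    { ⟦_⟧ = ι ; +-homo = ι-+ ; *-homo = ι-* ; -‿homo = ι-neg ; 0-homo = refl ; 1-homo = ι-1 }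

  import Algebra.Solver.Ring

  -- With integer coefficients, their equality is decidable even where equality in R is not. The
  -- constant `con (+ 1)` means `ι (+ 1)`, that is `1# + 0#`. Hence `1#` itself enters the solved
  -- identities as a variable, and its unit law is applied separately.
  module Solver = Algebra.Solver.Ring ℤ.+-*-rawRing (fromCommutativeRing R) ι-morphism
    (λ i j → Maybe.map (λ i≡j → reflexive (≡.cong ι i≡j)) (dec⇒maybe (i ℤ.≟ j)))

-- Finite sums over a semiring, for use in both F and ℤ

module RangeSum {c ℓ} (R : Semiring c ℓ) where
  open Semiring R hiding (zero)
  open import Algebra.Properties.Semiring.Sum R public
  open import Relation.Binary.Reasoning.Setoid setoid

  -- The summand lives on ℕ and not on `Fin n`, so that ranges can be split and shifted without
  -- casts.
  Σ< : ℕ → (ℕ → Carrier) → Carrier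
  Σ< n g = sum {n} (λ i → g (toℕ i))

  Σ<-cong : ∀ n {g h : ℕ → Carrier} → (∀ x → x ℕ.< n → g x ≈ h x) → Σ< n g ≈ Σ< n h
  Σ<-cong n eq = sum-cong-≋ (λ i → eq (toℕ i) (Fin.toℕ<n i))

  sum-zero : ∀ {n} {t : Fin n → Carrier} → (∀ i → t i ≈ 0#) → sum t ≈ 0#
  sum-zero {n} t≈0 = trans (sum-cong-≋ t≈0) (sum-replicate-zero n)

  sum-linear : ∀ {n} x y (f g : Fin n → Carrier) →
    sum (λ i → x * f i + y * g i) ≈ x * sum f + y * sum g
  sum-linear x y f g = trans (∑-distrib-+ (λ i → x * f i) (λ i → y * g i))
    (sym (+-cong (*-distribˡ-sum x f) (*-distribˡ-sum y g)))

  Σ<-+ : ∀ m n g → Σ< (m ℕ.+ n) g ≈ Σ< m g + Σ< n (λ x → g (m ℕ.+ x))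
  Σ<-+ zero n g = sym (+-identityˡ _)
  Σ<-+ (suc m) n g = trans (+-congˡ (Σ<-+ m n (λ x → g (suc x)))) (sym (+-assoc _ _ _))

  Σ<-single : ∀ n g {a} → a ℕ.< n → (∀ x → x ℕ.< n → ¬ (x ≡ a) → g x ≈ 0#) → Σ< n g ≈ g a
  Σ<-single (suc n) g {zero} _ g≈0 =
    trans (+-congˡ (sum-zero (λ i → g≈0 _ (ℕ.s≤s (Fin.toℕ<n i)) (λ ())))) (+-identityʳ _)
  Σ<-single (suc n) g {suc a} (ℕ.s≤s a<n) g≈0 =
    trans (+-cong (g≈0 0 (ℕ.s≤s ℕ.z≤n) (λ ()))
                  (Σ<-single n _ a<n (λ x x<n x≢a → g≈0 _ (ℕ.s≤s x<n) (λ e → x≢a (ℕ.suc-injective e)))))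
          (+-identityˡ _)

-- Divisibility by a prime

n∣n! : ∀ n .{{_ : ℕ.NonZero n}} → n ℕ.∣ n !
n∣n! (suc n) = ℕ.m∣m*n (n !)

module _ {p} (p-prime : Prime p) where

  prime∤! : ∀ k → k < p → ¬ (p ℕ.∣ k !)
  prime∤! zero    _   p∣1 = ℕ.<⇒≱ (ℕ.nonTrivial⇒n>1 p {{prime⇒nonTrivial p-prime}}) (ℕ.∣⇒≤ p∣1)
  prime∤! (suc k) k<p p∣k! with euclidsLemma (suc k) (k !) p-prime p∣k!
  ... | inj₁ p∣k = ℕ.<⇒≱ k<p (ℕ.∣⇒≤ p∣k)
  ... | inj₂ p∣k! = prime∤! k (ℕ.<-trans (ℕ.n<1+n k) k<p) p∣k!

  -- p divides p! = C(p,k) k! (p - k)!, but neither factorial on the right, as both k and p - k are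
  -- less than p.
  prime∣C : ∀ k → 0 < k → k < p → p ℕ.∣ p C k
  prime∣C k 0<k k<p =
    [ (λ p∣C → p∣C)
    , (λ p∣k!l! → ⊥-elim ([ prime∤! k k<p , prime∤! (p ∸ k) p∸k<p ]′
        (euclidsLemma (k !) ((p ∸ k) !) p-prime p∣k!l!)))
    ]′ (euclidsLemma (p C k) (k ! ℕ.* (p ∸ k) !) p-prime (≡.subst (p ℕ.∣_) p!≡ p∣p!))
    where
    instance
      _ = prime⇒nonZero p-prime
      _ = ℕ._!*_!≢0 k (p ∸ k)
    p∸k<p : p ∸ k < p
    p∸k<p = ℕ.∸-monoʳ-< 0<k (ℕ.<⇒≤ k<p)
    p!≡ : p ! ≡ (p C k) ℕ.* (k ! ℕ.* (p ∸ k) !)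
    p!≡ = ≡.sym (≡.trans (≡.cong (ℕ._* (k ! ℕ.* (p ∸ k) !)) (nCk≡n!/k![n-k]! (ℕ.<⇒≤ k<p)))
                         (ℕ.m/n*n≡m (k![n∸k]!∣n! (ℕ.<⇒≤ k<p))))
    p∣p! : p ℕ.∣ p !
    p∣p! = n∣n! p

  prime∣* : ∀ i j → + p ∣ℤ i ℤ.* j → + p ∣ℤ i ⊎ + p ∣ℤ j
  prime∣* i j p∣ij with euclidsLemma ∣ i ∣ ∣ j ∣ p-prime (≡.subst (p ℕ.∣_) (ℤ.abs-* i j) (ℤ.∣⇒∣ᵤ p∣ij))
  ... | inj₁ p∣i = inj₁ (ℤ.∣ᵤ⇒∣ p∣i)
  ... | inj₂ p∣j = inj₂ (ℤ.∣ᵤ⇒∣ p∣j)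

  prime∤1 : ¬ (+ p ∣ℤ + 1)
  -- Here 1 is read as `0 !`.
  prime∤1 p∣1 = prime∤! 0 (ℕ.>-nonZero⁻¹ p) (ℤ.∣⇒∣ᵤ p∣1)
    where instance _ = prime⇒nonZero p-prime

  prime∣^ : ∀ i n → + p ∣ℤ i ℤ.^ n → + p ∣ℤ i
  prime∣^ i zero p∣1 = ⊥-elim (prime∤1 p∣1)
  prime∣^ i (suc n) p∣ = [ (λ p∣i → p∣i) , prime∣^ i n ]′ (prime∣* i _ p∣)

-- The integers of the p-th cyclotomic field

module FieldLemmas {c ℓ} (F : Field c ℓ) (char0 : CharZero F) where
  open Field F hiding (zero)
  open IntegerImage commutativeRing public
  open RangeSum semiring public
  open import Algebra.Properties.Ring ring using (-0#≈0#; x∙y⁻¹≈ε⇒x≈y; x≈y⇒x∙y⁻¹≈ε; -‿involutive) public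
  open import Relation.Binary.Reasoning.Setoid setoid
  open Solver using (solve; _:=_; _:+_; _:*_; _:-_; :-_; con)

  x*y≈0⇒y≈0 : ∀ {x y} → ¬ (x ≈ 0#) → x * y ≈ 0# → y ≈ 0#
  x*y≈0⇒y≈0 {x} {y} x≉0 xy≈0 = begin
    y                  ≈⟨ *-identityˡ y ⟨
    1# * y             ≈⟨ *-congʳ (inverseʳ x x≉0) ⟨
    x * x ⁻¹ * y       ≈⟨ solve 3 (λ a b c → a :* b :* c := b :* (a :* c)) refl x (x ⁻¹) y ⟩
    x ⁻¹ * (x * y)     ≈⟨ *-congˡ xy≈0 ⟩
    x ⁻¹ * 0#          ≈⟨ zeroʳ _ ⟩
    0#                 ∎

  *-cancelˡ-≉0 : ∀ {x y z} → ¬ (x ≈ 0#) → x * y ≈ x * z → y ≈ z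
  *-cancelˡ-≉0 {x} {y} {z} x≉0 eq = x∙y⁻¹≈ε⇒x≈y y z (x*y≈0⇒y≈0 x≉0 (begin
    x * (y - z)    ≈⟨ solve 3 (λ a b c → a :* (b :- c) := a :* b :- a :* c) refl x y z ⟩
    x * y - x * z  ≈⟨ x≈y⇒x∙y⁻¹≈ε eq ⟩
    0#             ∎))

  ι≈0⇒≡0 : ∀ i → ι i ≈ 0# → i ≡ + 0
  ι≈0⇒≡0 (+ n)     eq = ≡.cong +_ (char0 n eq)
  ι≈0⇒≡0 -[1+ n ]  eq with () ← char0 (suc n) (trans (sym (-‿involutive _)) (trans (-‿cong eq) -0#≈0#))

  module _ {p} (p-prime : Prime p) where

    -- Fraction-free elimination: the determinant of M is nonzero modulo p.
    diagonal-mod-p⇒injective : ∀ {k} (M : Fin k → Fin k → ℤ) (v : Fin k → Carrier) →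
      (∀ i → ¬ (+ p ∣ℤ M i i)) → (∀ i j → i ≢ j → + p ∣ℤ M i j) →
      (∀ i → sum (λ j → ι (M i j) * v j) ≈ 0#) → ∀ j → v j ≈ 0#
    diagonal-mod-p⇒injective {suc k} M v diag off Mv≈0 = λ where
        zero    → v₀≈0
        (suc j) → tail≈0 j
      where
      M₀₀ : ℤ
      M₀₀ = M zero zero
      -- The subtracted term contains `M zero (suc j)`, an off-diagonal entry. Modulo p, clearing
      -- column zero therefore only multiplies the remaining block by `M₀₀`, which is prime to p.
      M′ : Fin k → Fin k → ℤ
      M′ i j = M₀₀ ℤ.* M (suc i) (suc j) ℤ.+ (ℤ.- M (suc i) zero) ℤ.* M zero (suc j)
      row : Fin (suc k) → Fin k → Carrier
      row i j = ι (M i (suc j)) * v (suc j)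
      p∣tail : ∀ i j → + p ∣ℤ (ℤ.- M (suc i) zero) ℤ.* M zero (suc j)
      p∣tail i j = ℤ.∣n⇒∣m*n (ℤ.- M (suc i) zero) (off zero (suc j) λ ())
      diag′ : ∀ i → ¬ (+ p ∣ℤ M′ i i)
      diag′ i p∣ = [ diag zero , diag (suc i) ]′
        (prime∣* p-prime M₀₀ _ (ℤ.∣m+n∣n⇒∣m p∣ (p∣tail i i)))
      off′ : ∀ i j → i ≢ j → + p ∣ℤ M′ i j
      off′ i j i≢j = ℤ.∣m∣n⇒∣m+n
        (ℤ.∣n⇒∣m*n M₀₀ (off (suc i) (suc j) (i≢j ∘ Fin.suc-injective))) (p∣tail i j)
      M′v≈0 : ∀ i → sum (λ j → ι (M′ i j) * v (suc j)) ≈ 0#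
      M′v≈0 i = begin
        sum (λ j → ι (M′ i j) * v (suc j))
          ≈⟨ sum-cong-≋ (λ j → trans (*-congʳ (trans (ι-+ (M₀₀ ℤ.* M (suc i) (suc j)) _)
               (+-cong (ι-* M₀₀ _) (ι-* (ℤ.- a) _))))
               (solve 5 (λ a b c d e → (a :* b :+ c :* d) :* e := a :* (b :* e) :+ c :* (d :* e)) refl
                 (ι M₀₀) (ι (M (suc i) (suc j))) (ι (ℤ.- a)) (ι (M zero (suc j))) (v (suc j)))) ⟩
        sum (λ j → ι M₀₀ * row (suc i) j + ι (ℤ.- a) * row zero j)
          ≈⟨ sum-linear (ι M₀₀) (ι (ℤ.- a)) (row (suc i)) (row zero) ⟩
        ι M₀₀ * sum (row (suc i)) + ι (ℤ.- a) * sum (row zero)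
          ≈⟨ +-congˡ (*-congʳ (ι-neg a)) ⟩
        ι M₀₀ * sum (row (suc i)) + (- ι a) * sum (row zero)
          ≈⟨ solve 5 (λ m s a t x → m :* s :+ (:- a) :* t := m :* (a :* x :+ s) :- a :* (m :* x :+ t)) refl
               (ι M₀₀) (sum (row (suc i))) (ι a) (sum (row zero)) (v zero) ⟩
        ι M₀₀ * (ι a * v zero + sum (row (suc i))) - ι a * (ι M₀₀ * v zero + sum (row zero))
          ≈⟨ +-cong (*-congˡ (Mv≈0 (suc i))) (-‿cong (*-congˡ (Mv≈0 zero))) ⟩
        ι M₀₀ * 0# - ι a * 0#
          ≈⟨ solve 2 (λ m a → m :* con (+ 0) :- a :* con (+ 0) := con (+ 0)) refl (ι M₀₀) (ι a) ⟩
        0# ∎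
        where a = M (suc i) zero
      tail≈0 : ∀ j → v (suc j) ≈ 0#
      tail≈0 = diagonal-mod-p⇒injective M′ (v ∘ suc) diag′ off′ M′v≈0
      v₀≈0 : v zero ≈ 0#
      v₀≈0 = x*y≈0⇒y≈0 (λ eq → diag zero (≡.subst (+ p ∣ℤ_) (≡.sym (ι≈0⇒≡0 M₀₀ eq)) (divides (+ 0) ≡.refl)))
        (begin
          ι M₀₀ * v zero                     ≈⟨ +-identityʳ _ ⟨
          ι M₀₀ * v zero + 0#                ≈⟨ +-congˡ (sum-zero (λ j → trans (*-congˡ (tail≈0 j)) (zeroʳ _))) ⟨
          ι M₀₀ * v zero + sum (row zero)    ≈⟨ Mv≈0 zero ⟩
          0#                                 ∎)

module CyclotomicIntegers {c ℓ} (F : Field c ℓ) (char0 : CharZero F)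
  {q} (p-prime : Prime (suc (suc q))) {ζ} (ζ-prim : PrimitiveRoot F (suc (suc q)) ζ) where
  open Field F hiding (zero)
  open FieldLemmas F char0
  open import Algebra.Properties.Semiring.Exp semiring using (^-homo-*; ^-congˡ)
  open import Algebra.Properties.Semiring.Mult semiring using (×-congʳ; ×-assoc-*)
  open import Algebra.Properties.CommutativeSemiring.Binomial commutativeSemiring
    using (binomialTerm) renaming (theorem to binomial-theorem)
  open import Relation.Binary.Reasoning.Setoid setoid
  open Solver using (solve; _:=_; _:+_; _:*_; _:-_; :-_; con)

  p : ℕ
  p = suc (suc q)

  ιp : Carrier
  ιp = ι (+ p)

  -- A predicate on F instead of a quotient of a polynomial ring: membership follows from closure,
  -- and coefficients are recovered only where needed, through `ℤ[ζ]*-Span`.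
  data ℤ[ζ] : Carrier → Set (c ⊔ ℓ) where
    ι∈   : ∀ i → ℤ[ζ] (ι i)
    ζ∈   : ℤ[ζ] ζ
    +∈   : ∀ {x y} → ℤ[ζ] x → ℤ[ζ] y → ℤ[ζ] (x + y)
    *∈   : ∀ {x y} → ℤ[ζ] x → ℤ[ζ] y → ℤ[ζ] (x * y)
    resp : ∀ {x y} → x ≈ y → ℤ[ζ] x → ℤ[ζ] y

  1∈ : ℤ[ζ] 1#
  1∈ = resp ι-1 (ι∈ (+ 1))

  -∈ : ∀ {x} → ℤ[ζ] x → ℤ[ζ] (- x)
  -∈ {x} x∈ = resp (solve 1 (λ x → con (ℤ.- + 1) :* x := :- x) refl x) (*∈ (ι∈ (ℤ.- + 1)) x∈)

  ^∈ : ∀ {x} n → ℤ[ζ] x → ℤ[ζ] (x ^ n)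
  ^∈ zero    x∈ = 1∈
  ^∈ (suc n) x∈ = *∈ x∈ (^∈ n x∈)

  eval : ∀ {n} → (Fin n → ℤ) → Carrier
  eval a = sum (λ j → ι (a j) * ζ ^ toℕ j)

  eval-suc : ∀ {n} (a : Fin (suc n) → ℤ) → eval a ≈ ι (a zero) + ζ * eval (a ∘ suc)
  eval-suc a = +-cong (*-identityʳ _) (trans
    (sum-cong-≋ (λ j → solve 3 (λ x y z → x :* (y :* z) := y :* (x :* z)) refl (ι (a (suc j))) ζ (ζ ^ toℕ j)))
    (sym (*-distribˡ-sum ζ (λ j → ι (a (suc j)) * ζ ^ toℕ j))))

  eval-linear : ∀ {n} x y (a b : Fin n → ℤ) →
    eval (λ j → x ℤ.* a j ℤ.+ y ℤ.* b j) ≈ ι x * eval a + ι y * eval b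
  eval-linear x y a b = trans
    (sum-cong-≋ (λ j → trans (*-congʳ (trans (ι-+ (x ℤ.* a j) _) (+-cong (ι-* x _) (ι-* y _))))
      (solve 5 (λ x a y b z → (x :* a :+ y :* b) :* z := x :* (a :* z) :+ y :* (b :* z)) refl
        (ι x) (ι (a j)) (ι y) (ι (b j)) (ζ ^ toℕ j))))
    (sum-linear (ι x) (ι y) (λ j → ι (a j) * ζ ^ toℕ j) (λ j → ι (b j) * ζ ^ toℕ j))

  eval∈ : ∀ {n} (a : Fin n → ℤ) → ℤ[ζ] (eval a)
  eval∈ {zero}  a = ι∈ (+ 0)
  eval∈ {suc n} a = resp (sym (eval-suc a)) (+∈ (ι∈ (a zero)) (*∈ ζ∈ (eval∈ (a ∘ suc))))

  -- All p powers of ζ are taken, although they are dependent: multiplication by ζ then just rotates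
  -- the coefficients, by ζ^p = 1.
  Span : Carrier → Set ℓ
  Span y = ∃ λ (a : Fin p → ℤ) → y ≈ eval a

  ζ*-Span : ∀ {y} → Span y → Span (ζ * y)
  ζ*-Span {y} (a , y≈) = rot , (begin
    ζ * y              ≈⟨ *-congˡ y≈ ⟩
    ζ * eval a         ≈⟨ *-congˡ (sum-init-last (λ j → ι (a j) * ζ ^ toℕ j)) ⟩
    ζ * (sum (λ j → ι (a (inject₁ j)) * ζ ^ toℕ (inject₁ j)) + ι (a top) * ζ ^ toℕ top)
                       ≈⟨ *-congˡ (+-cong (sum-cong-≋ {suc q} λ j → *-congˡ {ι (a (inject₁ j))} (reflexive (≡.cong (ζ ^_) (Fin.toℕ-inject₁ j))))
                                          (*-congˡ (reflexive (≡.cong (ζ ^_) (Fin.toℕ-fromℕ (suc q)))))) ⟩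
    ζ * (eval (a ∘ inject₁) + ι (a top) * ζ ^ suc q)
                       ≈⟨ solve 4 (λ z e t w → z :* (e :+ t :* w) := t :* (z :* w) :+ z :* e) refl
                            ζ (eval (a ∘ inject₁)) (ι (a top)) (ζ ^ suc q) ⟩
    ι (a top) * ζ ^ p + ζ * eval (a ∘ inject₁)
                       ≈⟨ +-congʳ (trans (*-congˡ (proj₁ ζ-prim)) (*-identityʳ _)) ⟩
    ι (a top) + ζ * eval (a ∘ inject₁)  ≈⟨ eval-suc rot ⟨
    eval rot ∎)
    where
    top = fromℕ (suc q)
    rot : Fin p → ℤ
    rot zero    = a top
    rot (suc j) = a (inject₁ j)

  -- Applied to y = ζ^i for every i, this yields an integer matrix for multiplication by x.
  ℤ[ζ]*-Span : ∀ {x y} → ℤ[ζ] x → Span y → Span (x * y)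
  ℤ[ζ]*-Span (ι∈ i) (a , y≈) = (λ j → i ℤ.* a j ℤ.+ + 0 ℤ.* a j) ,
    trans (*-congˡ y≈) (trans (solve 2 (λ i e → i :* e := i :* e :+ con (+ 0) :* e) refl (ι i) (eval a))
      (sym (eval-linear i (+ 0) a a)))
  ℤ[ζ]*-Span ζ∈ s = ζ*-Span s
  ℤ[ζ]*-Span {y = y} (+∈ {x} {x′} x∈ x′∈) s =
    let (a , xy≈) = ℤ[ζ]*-Span x∈ s ; (b , x′y≈) = ℤ[ζ]*-Span x′∈ s in
    (λ j → + 1 ℤ.* a j ℤ.+ + 1 ℤ.* b j) , (begin
      (x + x′) * y                 ≈⟨ distribʳ y x x′ ⟩
      x * y + x′ * y               ≈⟨ +-cong xy≈ x′y≈ ⟩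
      eval a + eval b              ≈⟨ solve 2 (λ a b → a :+ b := con (+ 1) :* a :+ con (+ 1) :* b) refl (eval a) (eval b) ⟩
      ι (+ 1) * eval a + ι (+ 1) * eval b ≈⟨ eval-linear (+ 1) (+ 1) a b ⟨
      eval (λ j → + 1 ℤ.* a j ℤ.+ + 1 ℤ.* b j) ∎)
  ℤ[ζ]*-Span (*∈ x∈ x′∈) s =
    let (a , eq) = ℤ[ζ]*-Span x∈ (ℤ[ζ]*-Span x′∈ s) in a , trans (*-assoc _ _ _) eq
  ℤ[ζ]*-Span (resp x≈x′ x∈) s =
    let (a , eq) = ℤ[ζ]*-Span x∈ s in a , trans (*-congʳ (sym x≈x′)) eq

  unit : ∀ {n} → Fin n → Fin n → ℤ
  unit i j = 𝟙 (toℕ j ℕ.≟ toℕ i)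

  eval-unit : ∀ {n} (i : Fin n) → eval (unit i) ≈ ζ ^ toℕ i
  eval-unit {n} i = trans
    (Σ<-single n (λ x → ι (𝟙 (x ℕ.≟ toℕ i)) * ζ ^ x) (Fin.toℕ<n i)
      (λ x _ x≢i → trans (*-congʳ (reflexive (≡.cong ι (𝟙-no (x ℕ.≟ toℕ i) x≢i)))) (zeroˡ _)))
    (trans (*-congʳ (trans (reflexive (≡.cong ι (𝟙-yes (toℕ i ℕ.≟ toℕ i) ≡.refl))) ι-1)) (*-identityˡ _))

  p∣ℤ? : ∀ i → Dec (+ p ∣ℤ i)
  p∣ℤ? i = + p ℤ.∣? i

  -- Nakayama: p ℤ[ζ] ∩ ℤ = p ℤ.
  ι≈p*x⇒p∣ : ∀ u {x} → ℤ[ζ] x → ι u ≈ ιp * x → + p ∣ℤ u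
  ι≈p*x⇒p∣ u {x} x∈ u≈px = decidable-stable (p∣ℤ? u) λ p∤u →
    1≉0 (diagonal-mod-p⇒injective p-prime M (λ j → ζ ^ toℕ j) (diag p∤u) off Mv≈0 zero)
    where
    C : Fin p → Fin p → ℤ
    C i = proj₁ (ℤ[ζ]*-Span x∈ (unit i , sym (eval-unit i)))
    xζⁱ≈ : ∀ i → x * ζ ^ toℕ i ≈ eval (C i)
    xζⁱ≈ i = proj₂ (ℤ[ζ]*-Span x∈ (unit i , sym (eval-unit i)))
    -- As C is a matrix of multiplication by x, the matrix u I - p C kills the vector of powers of
    -- ζ. If p did not divide u, it would be diagonal modulo p with diagonal entries prime to p, and
    -- the entry ζ^0 = 1 of the vector would vanish.
    M : Fin p → Fin p → ℤ
    M i j = u ℤ.* unit i j ℤ.+ (ℤ.- + p) ℤ.* C i j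
    p∣C : ∀ i j → + p ∣ℤ (ℤ.- + p) ℤ.* C i j
    p∣C i j = ℤ.∣m⇒∣m*n (C i j) (ℤ.∣m⇒∣-m (ℤ.∣-refl {+ p}))
    diag : ¬ (+ p ∣ℤ u) → ∀ i → ¬ (+ p ∣ℤ M i i)
    diag p∤u i p∣ = p∤u (≡.subst (+ p ∣ℤ_)
      (≡.trans (≡.cong (u ℤ.*_) (𝟙-yes (toℕ i ℕ.≟ toℕ i) ≡.refl)) (ℤ.*-identityʳ u))
      (ℤ.∣m+n∣n⇒∣m p∣ (p∣C i i)))
    off : ∀ i j → i ≢ j → + p ∣ℤ M i j
    off i j i≢j = ℤ.∣m∣n⇒∣m+n (divides (+ 0) (≡.trans
      (≡.cong (u ℤ.*_) (𝟙-no (toℕ j ℕ.≟ toℕ i) (λ eq → i≢j (≡.sym (Fin.toℕ-injective eq))))) (ℤ.*-zeroʳ u))) (p∣C i j)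
    Mv≈0 : ∀ i → eval (M i) ≈ 0#
    Mv≈0 i = begin
      eval (M i)
        ≈⟨ eval-linear u (ℤ.- + p) (unit i) (C i) ⟩
      ι u * eval (unit i) + ι (ℤ.- + p) * eval (C i)
        ≈⟨ +-cong (*-cong u≈px (eval-unit i)) (*-cong (ι-neg (+ p)) (sym (xζⁱ≈ i))) ⟩
      ιp * x * ζ ^ toℕ i + - ιp * (x * ζ ^ toℕ i)
        ≈⟨ solve 3 (λ p x z → p :* x :* z :+ (:- p) :* (x :* z) := con (+ 0)) refl ιp x (ζ ^ toℕ i) ⟩
      0# ∎

  -- The element π = ζ - 1 and the prime p

  π : Carrier
  π = ζ - 1#

  π∈ : ℤ[ζ] π
  π∈ = +∈ ζ∈ (-∈ 1∈)

  π≉0 : ¬ (π ≈ 0#)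
  π≉0 π≈0 = proj₂ ζ-prim 1 (s≤s z≤n) (s≤s (s≤s z≤n)) (trans (*-identityʳ ζ) (x∙y⁻¹≈ε⇒x≈y ζ 1# π≈0))

  p*π²∣_ : Carrier → Set (c ⊔ ℓ)
  p*π²∣ y = ∃ λ x → ℤ[ζ] x × y ≈ ιp * (π * (π * x))

  p*π²∣-sum : ∀ {n} (t : Fin n → Carrier) → (∀ i → p*π²∣ t i) → p*π²∣ sum t
  p*π²∣-sum {zero} t h = 0# , ι∈ (+ 0) , solve 2 (λ p π → con (+ 0) := p :* (π :* (π :* con (+ 0)))) refl ιp π
  p*π²∣-sum {suc n} t h =
    let (x , x∈ , t₀≈) = h zero ; (y , y∈ , Σt≈) = p*π²∣-sum (t ∘ suc) (h ∘ suc) in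
    x + y , +∈ x∈ y∈ , trans (+-cong t₀≈ Σt≈)
      (solve 4 (λ p π x y → p :* (π :* (π :* x)) :+ p :* (π :* (π :* y)) := p :* (π :* (π :* (x :+ y)))) refl ιp π x y)

  1^ : ∀ n → 1# ^ n ≈ 1#
  1^ zero = refl
  1^ (suc n) = trans (*-identityˡ _) (1^ n)

  term≈ : ∀ (k : Fin (suc p)) → binomialTerm π 1# p k ≈ ι (+ (p C toℕ k)) * π ^ toℕ k
  term≈ k = begin
    (p C toℕ k) · (π ^ toℕ k * 1# ^ (p ∸ toℕ k))  ≈⟨ ×-congʳ (p C toℕ k) (trans (*-congˡ (1^ (p ∸ toℕ k))) (trans (*-identityʳ _) (sym (*-identityˡ _)))) ⟩
    (p C toℕ k) · (1# * π ^ toℕ k)                 ≈⟨ ×-assoc-* (p C toℕ k) 1# (π ^ toℕ k) ⟨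
    ι (+ (p C toℕ k)) * π ^ toℕ k                  ∎

  -- Expand 1 = ζ ^ p = (π + 1) ^ p.
  π^p : ∃ λ x → ℤ[ζ] x × π ^ p + ιp * (π + π * (π * x)) ≈ 0#
  π^p = x , x∈ , (begin
      π ^ p + ιp * (π + π * (π * x))
        ≈⟨ solve 5 (λ a p π x o → a :+ p :* (π :+ π :* (π :* x)) :=
                               con (+ 1) :+ (p :* π :+ (p :* (π :* (π :* x)) :+ a)) :- con (+ 1)) refl (π ^ p) ιp π x 1# ⟩
      ι (+ 1) + (ιp * π + (ιp * (π * (π * x)) + π ^ p)) - ι (+ 1)
        ≈⟨ +-cong (+-congˡ (+-congˡ (+-congʳ (sym Σ≈)))) (-‿cong ι-1) ⟩
      ι (+ 1) + (ιp * π + (sum (t ∘ inject₁) + π ^ p)) - 1#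
        ≈⟨ +-congʳ expansion ⟨
      ζ ^ p - 1#
        ≈⟨ x≈y⇒x∙y⁻¹≈ε (proj₁ ζ-prim) ⟩
      0# ∎)
    where
    t : Fin (suc q) → Carrier
    t k = binomialTerm π 1# p (suc (suc k))
    -- The terms of degree 2, ..., p - 1: the binomial coefficient supplies p, the power of π
    -- supplies π².
    middle : ∀ k → p*π²∣ t (inject₁ k)
    middle k with prime∣C p-prime (suc (suc (toℕ (inject₁ k)))) (s≤s z≤n)
                   (s≤s (s≤s (≡.subst (_< q) (≡.sym (Fin.toℕ-inject₁ k)) (Fin.toℕ<n k))))
    ... | ℕ.divides b C≡ = ι (+ b) * π ^ toℕ (inject₁ k) , *∈ (ι∈ (+ b)) (^∈ (toℕ (inject₁ k)) π∈) , (begin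
      t (inject₁ k)
        ≈⟨ term≈ (suc (suc (inject₁ k))) ⟩
      ι (+ (p C suc (suc (toℕ (inject₁ k))))) * (π * (π * π ^ toℕ (inject₁ k)))
        ≈⟨ *-congʳ (trans (reflexive (≡.cong (λ n → ι (+ n)) C≡)) (trans (reflexive (≡.cong ι (ℤ.pos-* b p))) (ι-* (+ b) (+ p)))) ⟩
      ι (+ b) * ιp * (π * (π * π ^ toℕ (inject₁ k)))
        ≈⟨ solve 4 (λ b p π x → b :* p :* (π :* (π :* x)) := p :* (π :* (π :* (b :* x)))) refl (ι (+ b)) ιp π (π ^ toℕ (inject₁ k)) ⟩
      ιp * (π * (π * (ι (+ b) * π ^ toℕ (inject₁ k)))) ∎)
    x  = proj₁ (p*π²∣-sum (t ∘ inject₁) middle)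
    x∈ = proj₁ (proj₂ (p*π²∣-sum (t ∘ inject₁) middle))
    Σ≈ = proj₂ (proj₂ (p*π²∣-sum (t ∘ inject₁) middle))
    t₀≈ : binomialTerm π 1# p zero ≈ ι (+ 1)
    t₀≈ = trans (term≈ zero) (*-identityʳ _)
    t₁≈ : binomialTerm π 1# p (suc zero) ≈ ιp * π
    t₁≈ = trans (term≈ (suc zero)) (*-cong (reflexive (≡.cong (λ n → ι (+ n)) (nC1≡n p))) (*-identityʳ π))
    tₚ≈ : t (fromℕ q) ≈ π ^ p
    tₚ≈ = begin
      t (fromℕ q)                                ≈⟨ term≈ (suc (suc (fromℕ q))) ⟩
      ι (+ (p C suc (suc (toℕ (fromℕ q))))) * π ^ suc (suc (toℕ (fromℕ q)))
                                                 ≡⟨ ≡.cong (λ n → ι (+ (p C suc (suc n))) * π ^ suc (suc n)) (Fin.toℕ-fromℕ q) ⟩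
      ι (+ (p C p)) * π ^ p                      ≈⟨ *-congʳ (trans (reflexive (≡.cong (λ n → ι (+ n)) (nCn≡1 p))) ι-1) ⟩
      1# * π ^ p                                 ≈⟨ *-identityˡ _ ⟩
      π ^ p                                      ∎
    expansion : ζ ^ p ≈ ι (+ 1) + (ιp * π + (sum (t ∘ inject₁) + π ^ p))
    expansion = begin
      ζ ^ p          ≈⟨ ^-congˡ p (solve 2 (λ z o → z := z :- o :+ o) refl ζ 1#) ⟩
      (π + 1#) ^ p   ≈⟨ binomial-theorem p π 1# ⟩
      binomialTerm π 1# p zero + (binomialTerm π 1# p (suc zero) + sum t)
                     ≈⟨ +-cong t₀≈ (+-cong t₁≈ (trans (sum-init-last t) (+-congˡ tₚ≈))) ⟩
      ι (+ 1) + (ιp * π + (sum (t ∘ inject₁) + π ^ p)) ∎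

  -- The binomial expansion divided by π. The cofactor is -1 modulo π, so π^(p-1) and p agree up to
  -- sign and a term p π x.
  π^[p-1] : ∃ λ x → ℤ[ζ] x × π ^ suc q ≈ ιp * (- (1# + π * x))
  π^[p-1] = let (x , x∈ , eq) = π^p in x , x∈ , *-cancelˡ-≉0 π≉0 (begin
    π * π ^ suc q
      ≈⟨ solve 4 (λ a p π x → a := a :+ p :* (π :+ π :* (π :* x)) :- p :* (π :+ π :* (π :* x))) refl (π ^ p) ιp π x ⟩
    π ^ p + ιp * (π + π * (π * x)) - ιp * (π + π * (π * x))
      ≈⟨ +-congʳ eq ⟩
    0# - ιp * (π + π * (π * x))
      ≈⟨ +-congˡ (-‿cong (*-congˡ (+-congʳ (*-identityʳ π)))) ⟨
    0# - ιp * (π * 1# + π * (π * x))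
      ≈⟨ solve 4 (λ p π x o → con (+ 0) :- p :* (π :* o :+ π :* (π :* x)) := π :* (p :* (:- (o :+ π :* x)))) refl ιp π x 1# ⟩
    π * (ιp * (- (1# + π * x))) ∎)

  -- Bootstrapping on p = -π^(p-1) - p π x: if π^j divides p, then π^(j+1) divides the second term,
  -- and it divides the first as long as j + 1 ≤ p - 1. This avoids inverting 1 + π x in ℤ[ζ].
  π^∣p : ∀ j → j ≤ suc q → ∃ λ ε → ℤ[ζ] ε × ιp ≈ π ^ j * ε
  π^∣p zero _ = ιp , ι∈ (+ p) , sym (*-identityˡ _)
  π^∣p (suc j) (s≤s j≤q) =
    let (ε , ε∈ , p≈) = π^∣p j (ℕ.m≤n⇒m≤1+n j≤q) ; (x , x∈ , π^≈) = π^[p-1] in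
    - (π ^ (q ∸ j) + ε * x) , -∈ (+∈ (^∈ (q ∸ j) π∈) (*∈ ε∈ x∈)) , (begin
      ιp
        ≈⟨ *-identityʳ ιp ⟨
      ιp * 1#
        ≈⟨ solve 4 (λ p π x o → p :* o := :- (p :* (:- (o :+ π :* x)) :+ p :* π :* x)) refl ιp π x 1# ⟩
      - (ιp * (- (1# + π * x)) + ιp * π * x)
        ≈⟨ -‿cong (+-cong (sym π^≈) (*-congʳ (*-congʳ p≈))) ⟩
      - (π ^ suc q + π ^ j * ε * π * x)
        ≡⟨ ≡.cong (λ n → - (π ^ suc n + π ^ j * ε * π * x)) (ℕ.m+[n∸m]≡n j≤q) ⟨
      - (π * π ^ (j ℕ.+ (q ∸ j)) + π ^ j * ε * π * x)
        ≈⟨ -‿cong (+-congʳ (*-congˡ (^-homo-* π j (q ∸ j)))) ⟩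
      - (π * (π ^ j * π ^ (q ∸ j)) + π ^ j * ε * π * x)
        ≈⟨ solve 5 (λ π a b e x → :- (π :* (a :* b) :+ a :* e :* π :* x) := π :* a :* (:- (b :+ e :* x))) refl
             π (π ^ j) (π ^ (q ∸ j)) ε x ⟩
      π ^ suc j * (- (π ^ (q ∸ j) + ε * x)) ∎)

  ι-^ : ∀ u n → ι (u ℤ.^ n) ≈ ι u ^ n
  ι-^ u zero    = ι-1
  ι-^ u (suc n) = trans (ι-* u (u ℤ.^ n)) (*-congˡ (ι-^ u n))

  *-^ : ∀ x y n → (x * y) ^ n ≈ x ^ n * y ^ n
  *-^ x y zero = sym (*-identityˡ 1#)
  *-^ x y (suc n) = trans (*-congˡ (*-^ x y n))
    (solve 4 (λ x y a b → x :* y :* (a :* b) := x :* a :* (y :* b)) refl x y (x ^ n) (y ^ n))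

  -- In the (p-1)-th power of u = π x the factor π^(p-1) is a multiple of p, so p divides the
  -- integer u^(p-1).
  ι≈π*x⇒p∣ : ∀ u {x} → ℤ[ζ] x → ι u ≈ π * x → + p ∣ℤ u
  ι≈π*x⇒p∣ u {x} x∈ u≈ = let (y , y∈ , π^≈) = π^[p-1] in
    prime∣^ p-prime u (suc q) (ι≈p*x⇒p∣ (u ℤ.^ suc q)
      (*∈ (-∈ (+∈ 1∈ (*∈ π∈ y∈))) (^∈ (suc q) x∈)) (begin
        ι (u ℤ.^ suc q)                             ≈⟨ ι-^ u (suc q) ⟩
        ι u ^ suc q                                 ≈⟨ ^-congˡ (suc q) u≈ ⟩
        (π * x) ^ suc q                             ≈⟨ *-^ π x (suc q) ⟩
        π ^ suc q * x ^ suc q                       ≈⟨ *-congʳ π^≈ ⟩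
        ιp * (- (1# + π * y)) * x ^ suc q           ≈⟨ *-assoc _ _ _ ⟩
        ιp * (- (1# + π * y) * x ^ suc q)           ∎))

  -- Synthetic division by ζ - 1; the last component recovers a from the remainder and the quotient.
  divide-by-π : ∀ {n} (a : Fin (suc n) → ℤ) → ∃ λ r → ∃ λ (b : Fin n → ℤ) →
    eval a ≈ ι r + π * eval b × (∀ d → d ∣ℤ r → (∀ i → d ∣ℤ b i) → ∀ i → d ∣ℤ a i)
  divide-by-π {zero} a = a zero , (λ ()) ,
    trans (+-congʳ (*-identityʳ _)) (+-congˡ (sym (zeroʳ π))) ,
    (λ { d d∣r _ zero → d∣r })
  divide-by-π {suc n} a = let (r , b , eq , rec) = divide-by-π (a ∘ suc) in
    a zero ℤ.+ r , (r ∷ᵥ b) , (begin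
      eval a                                         ≈⟨ eval-suc a ⟩
      ι (a zero) + ζ * eval (a ∘ suc)                ≈⟨ +-congˡ (*-congˡ eq) ⟩
      ι (a zero) + ζ * (ι r + π * eval b)
        ≈⟨ solve 5 (λ a z r π b → a :+ z :* (r :+ π :* b) := a :+ z :* r :+ π :* (z :* b)) refl
             (ι (a zero)) ζ (ι r) π (eval b) ⟩
      ι (a zero) + ζ * ι r + π * (ζ * eval b)        ≈⟨ +-congʳ (+-congˡ (*-congʳ ζ≈)) ⟩
      ι (a zero) + (π + ι (+ 1)) * ι r + π * (ζ * eval b)
        ≈⟨ solve 4 (λ a π r zb → a :+ (π :+ con (+ 1)) :* r :+ π :* zb := a :+ r :+ π :* (r :+ zb)) refl
             (ι (a zero)) π (ι r) (ζ * eval b) ⟩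
      ι (a zero) + ι r + π * (ι r + ζ * eval b)      ≈⟨ +-cong (ι-+ (a zero) r) (*-congˡ (eval-suc (r ∷ᵥ b))) ⟨
      ι (a zero ℤ.+ r) + π * eval (r ∷ᵥ b)            ∎) , λ where
        d d∣r d∣b zero    → ℤ.∣m+n∣n⇒∣m d∣r (d∣b zero)
        d d∣r d∣b (suc i) → rec d (d∣b zero) (d∣b ∘ suc) i
    where
    ζ≈ : ζ ≈ π + ι (+ 1)
    ζ≈ = trans (solve 2 (λ z o → z := z :- o :+ o) refl ζ 1#) (+-congˡ (sym ι-1))

  -- Division by π leaves an integer remainder divisible by π, hence by p. As n ≤ p - 1, p is a
  -- multiple of π^n, so the remainder can be absorbed into the right side; cancelling π leaves a
  -- quotient with one coefficient fewer that is divisible by π^(n-1).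
  eval≈π^*x⇒p∣ : ∀ {n} → n ≤ suc q → (a : Fin n → ℤ) → ∀ {x} → ℤ[ζ] x → eval a ≈ π ^ n * x →
    ∀ i → + p ∣ℤ a i
  eval≈π^*x⇒p∣ {suc n} n<p-1 a {x} x∈ eq =
    let (r , b , a≈ , rec) = divide-by-π a
        r≈ = begin
          ι r                                       ≈⟨ solve 3 (λ r π b → r := r :+ π :* b :- π :* b) refl (ι r) π (eval b) ⟩
          ι r + π * eval b - π * eval b             ≈⟨ +-congʳ (trans (sym a≈) eq) ⟩
          π ^ suc n * x - π * eval b                ≈⟨ solve 4 (λ π y x b → π :* y :* x :- π :* b := π :* (y :* x :- b)) refl π (π ^ n) x (eval b) ⟩
          π * (π ^ n * x - eval b)                  ∎
        p∣r = ι≈π*x⇒p∣ r (+∈ (*∈ (^∈ n π∈) x∈) (-∈ (eval∈ b))) r≈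
        (ε , ε∈ , p≈) = π^∣p (suc n) n<p-1
        s = ℤ._∣_.quotient p∣r
        b≈ = *-cancelˡ-≉0 π≉0 (begin
          π * eval b                                ≈⟨ solve 3 (λ r π b → π :* b := r :+ π :* b :- r) refl (ι r) π (eval b) ⟩
          ι r + π * eval b - ι r                    ≈⟨ +-cong (trans (sym a≈) eq) (-‿cong (trans (reflexive (≡.cong ι (ℤ._∣_.equality p∣r)))
                                                          (trans (ι-* s (+ p)) (*-congˡ p≈)))) ⟩
          π ^ suc n * x - ι s * (π ^ suc n * ε)     ≈⟨ solve 5 (λ π y x s e → π :* y :* x :- s :* (π :* y :* e) := π :* (y :* (x :- s :* e))) refl
                                                          π (π ^ n) x (ι s) ε ⟩
          π * (π ^ n * (x - ι s * ε))               ∎)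
    in rec (+ p) p∣r (eval≈π^*x⇒p∣ (ℕ.<⇒≤ n<p-1) b (+∈ x∈ (-∈ (*∈ (ι∈ s) ε∈))) b≈)

  -- The value 0 is divisible by π^n, so p divides all coefficients of a relation. Dividing them by
  -- p gives a relation again, because p is nonzero in F.
  p^∣coefficients : ∀ k {n} → n ≤ suc q → (a : Fin n → ℤ) → eval a ≈ 0# → ∀ i → (+ p) ℤ.^ k ∣ℤ a i
  p^∣coefficients zero n≤ a eq i = divides (a i) (≡.sym (ℤ.*-identityʳ (a i)))
  p^∣coefficients (suc k) {n} n≤ a eq i = ≡.subst (_ ∣ℤ_) (≡.sym (a≡ i))
    (≡.subst (_∣ℤ s i ℤ.* + p) (ℤ.*-comm ((+ p) ℤ.^ k) (+ p))
      (ℤ.*-monoˡ-∣ (+ p) (p^∣coefficients k n≤ s (x*y≈0⇒y≈0 ιp≉0 ps≈0) i)))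
    where
    p∣ = eval≈π^*x⇒p∣ n≤ a (ι∈ (+ 0)) (trans eq (sym (zeroʳ _)))
    s = λ j → ℤ._∣_.quotient (p∣ j)
    a≡ : ∀ j → a j ≡ s j ℤ.* + p
    a≡ j = ℤ._∣_.equality (p∣ j)
    ιp≉0 : ¬ (ιp ≈ 0#)
    ιp≉0 eq′ with () ← ι≈0⇒≡0 (+ p) eq′
    ps≈0 : ιp * eval s ≈ 0#
    ps≈0 = begin
      ιp * eval s   ≈⟨ *-distribˡ-sum ιp (λ j → ι (s j) * ζ ^ toℕ j) ⟩
      sum (λ j → ιp * (ι (s j) * ζ ^ toℕ j))
        ≈⟨ sum-cong-≋ (λ j → trans (solve 3 (λ p s z → p :* (s :* z) := s :* p :* z) refl ιp (ι (s j)) (ζ ^ toℕ j))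
             (*-congʳ (trans (sym (ι-* (s j) (+ p))) (reflexive (≡.cong ι (≡.sym (a≡ j))))))) ⟩
      eval a        ≈⟨ eq ⟩
      0#            ∎

  n<p^n : ∀ n → n < ∣ (+ p) ℤ.^ n ∣
  n<p^n zero = s≤s z≤n
  n<p^n (suc n) = ℕ.<-≤-trans (s≤s (n<p^n n)) (≡.subst (suc ∣ (+ p) ℤ.^ n ∣ ≤_) (≡.sym (ℤ.abs-* (+ p) ((+ p) ℤ.^ n)))
    (ℕ.+-mono-≤ (ℕ.≤-trans (s≤s z≤n) (n<p^n n)) (ℕ.m≤m+n _ _)))

  -- The exponent is chosen as m = |a i| itself: p^m > m, so p^m divides m only if m = 0.
  linearly-independent : ∀ {n} → n ≤ suc q → (a : Fin n → ℤ) → eval a ≈ 0# → ∀ i → a i ≡ + 0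
  linearly-independent n≤ a eq i = ℤ.∣i∣≡0⇒i≡0 (zero-abs ∣ a i ∣ (ℤ.∣⇒∣ᵤ (p^∣coefficients ∣ a i ∣ n≤ a eq i)))
    where
    zero-abs : ∀ m → ∣ (+ p) ℤ.^ m ∣ ℕ.∣ m → m ≡ 0
    zero-abs zero _ = ≡.refl
    zero-abs (suc m) p^∣ = contradiction (ℕ.∣⇒≤ p^∣) (ℕ.<⇒≱ (n<p^n (suc m)))

-- Linear dependence over ℤ

module ℤ-Sum = RangeSum ℤ.+-*-semiring

module _ where
  open ℤ-Sum
  open import Data.Integer.Base using (_+_; _*_; -_; _-_)
  open import Relation.Binary.PropositionalEquality using (refl; sym; trans; cong; cong₂; subst; subst₂; module ≡-Reasoning)

  *≢0 : ∀ {i j} → i ≢ + 0 → j ≢ + 0 → i * j ≢ + 0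
  *≢0 {i} i≢0 j≢0 ij≡0 = [ i≢0 , j≢0 ]′ (ℤ.i*j≡0⇒i≡0∨j≡0 i ij≡0)

  i*j≡0⇒j≡0 : ∀ {i j} → i ≢ + 0 → i * j ≡ + 0 → j ≡ + 0
  i*j≡0⇒j≡0 {i} i≢0 ij≡0 = [ (λ i≡0 → contradiction i≡0 i≢0) , id ]′ (ℤ.i*j≡0⇒i≡0∨j≡0 i ij≡0)

  Dependent : ∀ {k N} → (Fin k → Fin N → ℤ) → Set
  Dependent {k} w = ∃ λ (a : Fin k → ℤ) → (∃ λ m → a m ≢ + 0) × (∀ i → sum (λ m → a m * w m i) ≡ + 0)

  -- The rank t of the projection e / s is recorded through its trace.
  record ScaledProjection {N} (e : Fin N → Fin N → ℤ) (s t : ℤ) : Set where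
    field
      s≢0        : s ≢ + 0
      idempotent : ∀ i j → sum (λ l → e i l * e l j) ≡ s * e i j
      trace      : sum (λ i → e i i) ≡ s * t
  open ScaledProjection

  Fixes : ∀ {N} → (Fin N → Fin N → ℤ) → ℤ → (Fin N → ℤ) → Set
  Fixes e s w = ∀ i → sum (λ j → e i j * w j) ≡ s * w i

  Fixes-linear : ∀ {N} (e : Fin N → Fin N → ℤ) {s} a b {u v : Fin N → ℤ} → Fixes e s u → Fixes e s v →
    Fixes e s (λ i → a * u i + b * v i)
  Fixes-linear e {s} a b {u} {v} fix-u fix-v i = begin
    sum (λ j → e i j * (a * u j + b * v j))
      ≡⟨ sum-cong-≋ (λ j → lemma₁ (e i j) a (u j) b (v j)) ⟩
    sum (λ j → a * (e i j * u j) + b * (e i j * v j))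
      ≡⟨ sum-linear a b (λ j → e i j * u j) (λ j → e i j * v j) ⟩
    a * sum (λ j → e i j * u j) + b * sum (λ j → e i j * v j)
      ≡⟨ cong₂ (λ x y → a * x + b * y) (fix-u i) (fix-v i) ⟩
    a * (s * u i) + b * (s * v i)
      ≡⟨ lemma₂ s a (u i) b (v i) ⟩
    s * (a * u i + b * v i) ∎
    where
    open ≡-Reasoning
    lemma₁ : ∀ e a x b y → e * (a * x + b * y) ≡ a * (e * x) + b * (e * y)
    lemma₁ = solve-∀
    lemma₂ : ∀ s a x b y → a * (s * x) + b * (s * y) ≡ s * (a * x + b * y)
    lemma₂ = solve-∀

  -- Stated for all k, e, s and t at once, since an elimination step can change each of them. The
  -- rank t is an integer tied to e only by the trace; for N = 0 the trace equation forces t = 0.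
  DependenceBound : ℕ → Set
  DependenceBound N = ∀ {k e s t} (w : Fin k → Fin N → ℤ) → ScaledProjection e s t →
    (∀ m → Fixes e s (w m)) → t ℤ.< + k → Dependent w

  -- Vectors fixed by e / s then have coordinate zero equal to 0, so row and column zero can be
  -- deleted: the entries lost contribute nothing to the products or to the trace.
  zero-row : ∀ {N} → DependenceBound N → ∀ {k e s t} (w : Fin k → Fin (suc N) → ℤ) →
    ScaledProjection e s t → (∀ j → e zero j ≡ + 0) → (∀ m → Fixes e s (w m)) → t ℤ.< + k → Dependent w
  zero-row bound {k} {e} {s} {t} w E e₀≡0 fixes t<k = extend (bound (λ m → w m ∘ suc) E′ fixes′ t<k)
    where
    w₀≡0 : ∀ m → w m zero ≡ + 0
    w₀≡0 m = i*j≡0⇒j≡0 (s≢0 E) (trans (sym (fixes m zero))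
      (sum-zero (λ j → trans (cong (_* w m j) (e₀≡0 j)) (ℤ.*-zeroˡ (w m j)))))
    drop-first : ∀ {x y} → x ≡ + 0 → x + y ≡ y
    drop-first refl = ℤ.+-identityˡ _
    E′ : ScaledProjection (λ i j → e (suc i) (suc j)) s t
    E′ .s≢0 = s≢0 E
    E′ .idempotent i j = trans
      (sym (drop-first (trans (cong (e (suc i) zero *_) (e₀≡0 (suc j))) (ℤ.*-zeroʳ (e (suc i) zero))))) (idempotent E (suc i) (suc j))
    E′ .trace = trans (sym (drop-first (e₀≡0 zero))) (trace E)
    fixes′ : ∀ m → Fixes (λ i j → e (suc i) (suc j)) s (w m ∘ suc)
    fixes′ m i = trans (sym (drop-first (trans (cong (e (suc i) zero *_) (w₀≡0 m)) (ℤ.*-zeroʳ (e (suc i) zero))))) (fixes m (suc i))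
    extend : Dependent (λ m → w m ∘ suc) → Dependent w
    extend (a , a≢0 , rel) = a , a≢0 , λ where
      zero    → sum-zero (λ m → trans (cong (a m *_) (w₀≡0 m)) (ℤ.*-zeroʳ (a m)))
      (suc i) → rel i

  -- One step of fraction-free Gaussian elimination lowers the rank by one.
  module Pivot {N} {e : Fin (suc N) → Fin (suc N) → ℤ} {s t} (E : ScaledProjection e s t)
    (j₀ : Fin (suc N)) (v≢0 : e zero j₀ ≢ + 0) where

    v : ℤ
    v = e zero j₀

    -- Writing P = e / s, the matrix e′ / (s v) is P minus a rank-one matrix, the product of column
    -- j₀ and row zero, scaled to cancel row zero. It projects onto those vectors in the image of P
    -- whose coordinate zero vanishes.
    e′ : Fin (suc N) → Fin (suc N) → ℤ
    e′ i j = v * e i j + (- e i j₀) * e zero j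

    row-zero : ∀ j → e′ zero j ≡ + 0
    row-zero j = lemma v (e zero j)
      where
      lemma : ∀ a b → a * b + (- a) * b ≡ + 0
      lemma = solve-∀

    apply : ∀ i (u : Fin (suc N) → ℤ) →
      sum (λ l → e′ i l * u l) ≡ v * sum (λ l → e i l * u l) + (- e i j₀) * sum (λ l → e zero l * u l)
    apply i u = trans (sum-cong-≋ (λ l → lemma v (e i l) (e i j₀) (e zero l) (u l)))
      (sum-linear v (- e i j₀) (λ l → e i l * u l) (λ l → e zero l * u l))
      where
      lemma : ∀ a b c d x → (a * b + (- c) * d) * x ≡ a * (b * x) + (- c) * (d * x)
      lemma = solve-∀

    fixes′ : ∀ {u} → Fixes e s u → u zero ≡ + 0 → Fixes e′ (s * v) u
    fixes′ {u} fix u₀≡0 i = begin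
      sum (λ l → e′ i l * u l)
        ≡⟨ apply i u ⟩
      v * sum (λ l → e i l * u l) + (- e i j₀) * sum (λ l → e zero l * u l)
        ≡⟨ cong₂ (λ a b → v * a + (- e i j₀) * b) (fix i) (trans (fix zero) (cong (s *_) u₀≡0)) ⟩
      v * (s * u i) + (- e i j₀) * (s * + 0)
        ≡⟨ lemma v s (u i) (e i j₀) ⟩
      s * v * u i ∎
      where
      open ≡-Reasoning
      lemma : ∀ a b x y → a * (b * x) + (- y) * (b * + 0) ≡ b * a * x
      lemma = solve-∀

    projection : ScaledProjection e′ (s * v) (t - + 1)
    projection .s≢0 = *≢0 (s≢0 E) v≢0
    projection .idempotent i j = begin
      sum (λ l → e′ i l * e′ l j)
        ≡⟨ apply i (λ l → e′ l j) ⟩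
      v * sum (λ l → e i l * e′ l j) + (- e i j₀) * sum (λ l → e zero l * e′ l j)
        ≡⟨ cong₂ (λ a b → v * a + (- e i j₀) * b) (e*e′ i) (e*e′ zero) ⟩
      v * (s * e′ i j) + (- e i j₀) * (s * e′ zero j)
        ≡⟨ cong (λ x → v * (s * e′ i j) + (- e i j₀) * (s * x)) (row-zero j) ⟩
      v * (s * e′ i j) + (- e i j₀) * (s * + 0)
        ≡⟨ lemma v s (e′ i j) (e i j₀) ⟩
      s * v * e′ i j ∎
      where
      open ≡-Reasoning
      lemma : ∀ a b x y → a * (b * x) + (- y) * (b * + 0) ≡ b * a * x
      lemma = solve-∀
      lemma₁ : ∀ a b c d x → x * (a * b + (- c) * d) ≡ a * (x * b) + (- d) * (x * c)
      lemma₁ = solve-∀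
      lemma₂ : ∀ a b c d x → a * (x * b) + (- d) * (x * c) ≡ x * (a * b + (- c) * d)
      lemma₂ = solve-∀
      e*e′ : ∀ i → sum (λ l → e i l * e′ l j) ≡ s * e′ i j
      e*e′ i = begin
        sum (λ l → e i l * e′ l j)
          ≡⟨ sum-cong-≋ (λ l → lemma₁ v (e l j) (e l j₀) (e zero j) (e i l)) ⟩
        sum (λ l → v * (e i l * e l j) + (- e zero j) * (e i l * e l j₀))
          ≡⟨ sum-linear v (- e zero j) (λ l → e i l * e l j) (λ l → e i l * e l j₀) ⟩
        v * sum (λ l → e i l * e l j) + (- e zero j) * sum (λ l → e i l * e l j₀)
          ≡⟨ cong₂ (λ a b → v * a + (- e zero j) * b) (idempotent E i j) (idempotent E i j₀) ⟩
        v * (s * e i j) + (- e zero j) * (s * e i j₀)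
          ≡⟨ lemma₂ v (e i j) (e i j₀) (e zero j) s ⟩
        s * e′ i j ∎
    -- The trace of the rank-one part is the entry (zero, j₀) of e², equal to s v by idempotence.
    -- This is why t drops by exactly one.
    projection .trace = begin
      sum (λ i → v * e i i + (- e i j₀) * e zero i)
        ≡⟨ sum-cong-≋ (λ i → lemma₁ v (e i i) (e i j₀) (e zero i)) ⟩
      sum (λ i → v * e i i + (- + 1) * (e zero i * e i j₀))
        ≡⟨ sum-linear v (- + 1) (λ i → e i i) (λ i → e zero i * e i j₀) ⟩
      v * sum (λ i → e i i) + (- + 1) * sum (λ i → e zero i * e i j₀)
        ≡⟨ cong₂ (λ a b → v * a + (- + 1) * b) (trace E) (idempotent E zero j₀) ⟩
      v * (s * t) + (- + 1) * (s * v)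
        ≡⟨ lemma₂ v s t ⟩
      s * v * (t - + 1) ∎
      where
      open ≡-Reasoning
      lemma₁ : ∀ a b c d → a * b + (- c) * d ≡ a * b + (- + 1) * (d * c)
      lemma₁ = solve-∀
      lemma₂ : ∀ a b c → a * (b * c) + (- + 1) * (b * a) ≡ b * a * (c - + 1)
      lemma₂ = solve-∀

  module _ {k N} (w : Fin (suc k) → Fin (suc N) → ℤ) (m : Fin (suc k)) where
    eliminate : Fin k → Fin (suc N) → ℤ
    eliminate l i = w m zero * w (punchIn m l) i + (- w (punchIn m l) zero) * w m i

    eliminate-zero : ∀ l → eliminate l zero ≡ + 0
    eliminate-zero l = lemma (w m zero) (w (punchIn m l) zero)
      where
      lemma : ∀ a b → a * b + (- b) * a ≡ + 0
      lemma = solve-∀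

    eliminate-fixes : ∀ {e s} → (∀ l → Fixes e s (w l)) → ∀ l → Fixes e s (eliminate l)
    eliminate-fixes {e} {s} fixes l = Fixes-linear e {s} (w m zero) (- w (punchIn m l) zero) {w (punchIn m l)} {w m}
      (fixes (punchIn m l)) (fixes m)

    -- Expanding the eliminated vectors scales each coefficient by the nonzero `w m zero`, so a
    -- nonzero one survives; what falls on `w m` is collected in `aₘ`.
    eliminate-dependent : w m zero ≢ + 0 → Dependent eliminate → Dependent w
    eliminate-dependent wm≢0 (a , (l , aₗ≢0) , rel) = a′ ,
      (punchIn m l , λ eq → *≢0 wm≢0 aₗ≢0 (trans (sym (insertAt-punchIn xs m aₘ l)) eq)) , λ i → begin
        sum (λ l → a′ l * w l i)
          ≡⟨ sum-remove {i = m} (λ l → a′ l * w l i) ⟩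
        a′ m * w m i + sum (λ l → a′ (punchIn m l) * w (punchIn m l) i)
          ≡⟨ cong₂ _+_ (cong (_* w m i) (insertAt-lookup xs m aₘ))
               (sum-cong-≋ (λ l → trans (cong (_* w (punchIn m l) i) (insertAt-punchIn xs m aₘ l))
                 (ℤ.*-assoc (w m zero) (a l) (w (punchIn m l) i)))) ⟩
        aₘ * w m i + sum (λ l → w m zero * (a l * w (punchIn m l) i))
          ≡⟨ cong₂ _+_ (ℤ.*-comm aₘ (w m i)) (sym (*-distribˡ-sum (w m zero) (λ l → a l * w (punchIn m l) i))) ⟩
        w m i * aₘ + w m zero * sum (λ l → a l * w (punchIn m l) i)
          ≡⟨ sum-linear (w m i) (w m zero) (λ l → a l * (- w (punchIn m l) zero)) (λ l → a l * w (punchIn m l) i) ⟨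
        sum (λ l → w m i * (a l * (- w (punchIn m l) zero)) + w m zero * (a l * w (punchIn m l) i))
          ≡⟨ sum-cong-≋ (λ l → lemma (w m i) (a l) (- w (punchIn m l) zero) (w m zero) (w (punchIn m l) i)) ⟩
        sum (λ l → a l * eliminate l i)
          ≡⟨ rel i ⟩
        + 0 ∎
      where
      open ≡-Reasoning
      xs : Fin k → ℤ
      xs l = w m zero * a l
      aₘ : ℤ
      aₘ = sum (λ l → a l * (- w (punchIn m l) zero))
      a′ : Fin (suc k) → ℤ
      a′ = insertAt xs m aₘ
      lemma : ∀ x a b c y → x * (a * b) + c * (a * y) ≡ a * (c * y + b * x)
      lemma = solve-∀

  -- If row zero of e vanishes, the coordinate is dropped. Otherwise `Pivot` lowers t by one; the
  -- vectors must then vanish at coordinate zero, and if some `w m` does not, it is used to clear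
  -- the others, which lowers k by one as well. Either way t < k persists.
  dependence-bound : ∀ N → DependenceBound N
  dependence-bound zero {zero} {t = t} w E _ t<k = contradiction t<k (subst (λ t → ¬ (t ℤ.< + 0)) (sym t≡0) (ℤ.<-irrefl refl))
    where
    t≡0 : t ≡ + 0
    t≡0 = i*j≡0⇒j≡0 (s≢0 E) (sym (trace E))
  dependence-bound zero {suc k} w E _ t<k = (λ _ → + 1) , (zero , λ ()) , λ ()
  dependence-bound (suc N) {k} {e} {s} {t} w E fixes t<k with Fin.all? (λ j → e zero j ℤ.≟ + 0)
  ... | yes e₀≡0 = zero-row (dependence-bound N) w E e₀≡0 fixes t<k
  ... | no  e₀≢0 with Fin.¬∀⟶∃¬ _ _ (λ j → e zero j ℤ.≟ + 0) e₀≢0 | Fin.all? (λ m → w m zero ℤ.≟ + 0)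
  ...   | j₀ , v≢0 | yes w₀≡0 = zero-row (dependence-bound N) w projection row-zero
            (λ m → fixes′ (fixes m) (w₀≡0 m)) (ℤ.≤-<-trans (ℤ.i≤j⇒i-k≤j (+ 1) ℤ.≤-refl) t<k)
    where open Pivot E j₀ v≢0
  ...   | j₀ , v≢0 | no  w₀≢0 = pick w fixes t<k (Fin.¬∀⟶∃¬ _ _ (λ m → w m zero ℤ.≟ + 0) w₀≢0)
    where
    open Pivot E j₀ v≢0
    pick : ∀ {k} (w : Fin k → Fin (suc N) → ℤ) → (∀ m → Fixes e s (w m)) → t ℤ.< + k →
      (∃ λ m → w m zero ≢ + 0) → Dependent w
    pick {suc k} w fixes t<k (m , wm≢0) = eliminate-dependent w m wm≢0
      (zero-row (dependence-bound N) (eliminate w m) projection row-zero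
        (λ l → fixes′ (eliminate-fixes w m {e} {s} fixes l) (eliminate-zero w m l)) (ℤ.+-monoˡ-< (- + 1) t<k))

  -- Congruences and residue classes

  infix 4 _≡_mod_
  _≡_mod_ : ℤ → ℤ → ℕ → Set
  x ≡ y mod n = n ℕ.∣ ∣ x - y ∣

  mod-refl : ∀ {n} x → x ≡ x mod n
  mod-refl {n} x = subst (λ d → n ℕ.∣ ∣ d ∣) (sym (ℤ.+-inverseʳ x)) (n ℕ.∣0)

  mod-sym : ∀ {n} x y → x ≡ y mod n → y ≡ x mod n
  mod-sym {n} x y = subst (n ℕ.∣_) (ℤ.∣i-j∣≡∣j-i∣ x y)

  mod-trans : ∀ {n} x y z → x ≡ y mod n → y ≡ z mod n → x ≡ z mod n
  mod-trans {n} x y z x≡y y≡z = subst (λ d → n ℕ.∣ ∣ d ∣) (lemma x y z)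
    (ℤ.∣⇒∣ᵤ {+ n} {(x - y) + (y - z)} (ℤ.∣m∣n⇒∣m+n (ℤ.∣ᵤ⇒∣ {+ n} {x - y} x≡y) (ℤ.∣ᵤ⇒∣ {+ n} {y - z} y≡z)))
    where
    lemma : ∀ x y z → (x - y) + (y - z) ≡ x - z
    lemma = solve-∀

  mod-intro : ∀ {n} x y k → x - y ≡ k * + n → x ≡ y mod n
  mod-intro {n} x y k eq = ℤ.∣⇒∣ᵤ {+ n} {x - y} (divides k eq)

  𝟙-cong : ∀ {a b} {P : Set a} {Q : Set b} (P? : Dec P) (Q? : Dec Q) → (P → Q) → (Q → P) → 𝟙 P? ≡ 𝟙 Q?
  𝟙-cong P? (yes Q) to from = 𝟙-yes P? (from Q)
  𝟙-cong P? (no ¬Q) to from = 𝟙-no P? (¬Q ∘ to)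

  δ : ℕ → ℤ → ℤ → ℤ
  δ n x y = 𝟙 (n ℕ.∣? ∣ x - y ∣)

  δ-congˡ : ∀ n x x′ y → x ≡ x′ mod n → δ n x y ≡ δ n x′ y
  δ-congˡ n x x′ y x≡x′ = 𝟙-cong (n ℕ.∣? ∣ x - y ∣) (n ℕ.∣? ∣ x′ - y ∣) (mod-trans x′ x y (mod-sym x x′ x≡x′)) (mod-trans x x′ y x≡x′)

  mod-<⇒≡ : ∀ {n x y} → x ℕ.< n → y ℕ.< n → + x ≡ + y mod n → x ≡ y
  mod-<⇒≡ {n} {x} {y} x<n y<n n∣ = ℤ.+-injective (ℤ.i-j≡0⇒i≡j (+ x) (+ y) (ℤ.∣i∣≡0⇒i≡0 (small _ ∣x-y∣<n n∣)))
    where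
    ∣x-y∣<n : ∣ + x - + y ∣ ℕ.< n
    ∣x-y∣<n = subst (λ d → ∣ d ∣ ℕ.< n) (sym (ℤ.[+m]-[+n]≡m⊖n x y))
      (ℕ.≤-<-trans (ℤ.∣m⊝n∣≤m⊔n x y) (ℕ.⊔-pres-<m x<n y<n))
    small : ∀ d → d ℕ.< n → n ℕ.∣ d → d ≡ 0
    small zero    _   _  = refl
    small (suc d) d<n n∣ = contradiction (ℕ.∣⇒≤ n∣) (ℕ.<⇒≱ d<n)

  mod-shift : ∀ n x → + (n ℕ.+ x) ≡ + x mod n
  mod-shift n x = mod-intro (+ (n ℕ.+ x)) (+ x) (+ 1) (trans (cong (_- + x) (ℤ.pos-+ n x)) (lemma (+ n) (+ x)))
    where
    lemma : ∀ a b → (a + b) - b ≡ + 1 * a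
    lemma = solve-∀

  mod-+ʳ : ∀ {n} x y s → + x ≡ + y mod n → + (x ℕ.+ s) ≡ + (y ℕ.+ s) mod n
  mod-+ʳ {n} x y s = subst (λ d → n ℕ.∣ ∣ d ∣)
    (sym (trans (cong₂ _-_ (ℤ.pos-+ x s) (ℤ.pos-+ y s)) (lemma (+ x) (+ y) (+ s))))
    where
    lemma : ∀ x y s → (x + s) - (y + s) ≡ x - y
    lemma = solve-∀

  mod-residue : ∀ x n .{{_ : ℕ.NonZero n}} → x ≡ + (x ℤ.%ℕ n) mod n
  mod-residue x n = mod-intro x (+ (x ℤ.%ℕ n)) (x ℤ./ℕ n)
    (trans (cong (_- + (x ℤ.%ℕ n)) (ℤ.a≡a%ℕn+[a/ℕn]*n x n)) (lemma (+ (x ℤ.%ℕ n)) _))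
    where
    lemma : ∀ a b → (a + b) - a ≡ b
    lemma = solve-∀

  sum-const : ∀ n c → sum {n} (λ _ → c) ≡ + n * c
  sum-const zero    c = sym (ℤ.*-zeroˡ c)
  sum-const (suc n) c = trans (cong (λ x → c + x) (sum-const n c)) (sym (ℤ.suc-* (+ n) c))

  Σ<-δ-block : ∀ {n} a → a ℕ.< n → Σ< n (λ x → δ n (+ x) (+ a)) ≡ + 1
  Σ<-δ-block {n} a a<n = trans
    (Σ<-single n _ a<n (λ x x<n x≢a → 𝟙-no (n ℕ.∣? _) (x≢a ∘ mod-<⇒≡ x<n a<n)))
    (𝟙-yes (n ℕ.∣? _) (mod-refl {n} (+ a)))

  -- The range consists of N / n blocks, each meeting the class once. The factor n keeps the
  -- quotient out of the statement.
  residue-count : ∀ {N} n r → n ℕ.∣ N → .{{ℕ.NonZero N}} → + n * Σ< N (λ x → δ n (+ x) r) ≡ + N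
  residue-count {N} n r (ℕ.divides q refl) = begin
    + n * Σ< (q ℕ.* n) (λ x → δ n (+ x) r)       ≡⟨ cong (+ n *_) (Σ<-cong (q ℕ.* n) (λ x _ → 𝟙-cong (n ℕ.∣? ∣ + x - r ∣) (n ℕ.∣? ∣ + x - + a ∣)
                                                       (λ x≡r → mod-trans (+ x) r (+ a) x≡r r≡a)
                                                       (λ x≡a → mod-trans (+ x) (+ a) r x≡a (mod-sym r (+ a) r≡a)))) ⟩
    + n * Σ< (q ℕ.* n) (λ x → δ n (+ x) (+ a))   ≡⟨ cong (+ n *_) (blocks q) ⟩
    + n * + q                                    ≡⟨ ℤ.*-comm (+ n) (+ q) ⟩
    + q * + n                                    ≡⟨ ℤ.pos-* q n ⟨
    + (q ℕ.* n)                                  ∎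
    where
    open ≡-Reasoning
    instance _ = ℕ.m*n≢0⇒n≢0 q {n}
    a = r ℤ.%ℕ n
    r≡a : r ≡ + a mod n
    r≡a = mod-residue r n
    blocks : ∀ q → Σ< (q ℕ.* n) (λ x → δ n (+ x) (+ a)) ≡ + q
    blocks zero = refl
    blocks (suc q) = trans (Σ<-+ n (q ℕ.* n) (λ x → δ n (+ x) (+ a))) (cong₂ _+_ (Σ<-δ-block a (ℤ.n%ℕd<d r n))
      (trans (Σ<-cong (q ℕ.* n) (λ x _ → δ-congˡ n (+ (n ℕ.+ x)) (+ x) (+ a) (mod-shift n x))) (blocks q)))

  Bézoutℤ : ∀ a b → ∃ λ s → ∃ λ t → + gcd a b ≡ s * + a + t * + b
  Bézoutℤ a b with Bézout.identity (gcd-GCD a b)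
  ... | Bézout.+- x y eq = + x , - + y , trans (lemma (+ gcd a b) (+ y * + b))
          (cong₂ _+_ (trans (cong (λ z → + gcd a b + z) (sym (ℤ.pos-* y b))) (trans (cong +_ eq) (ℤ.pos-* x a)))
            (ℤ.neg-distribˡ-* (+ y) (+ b)))
    where
    lemma : ∀ g z → g ≡ (g + z) + - z
    lemma = solve-∀
  ... | Bézout.-+ x y eq = - + x , + y , trans (lemma (+ gcd a b) (+ x * + a))
          (cong₂ _+_ (ℤ.neg-distribˡ-* (+ x) (+ a))
            (trans (cong (λ z → + gcd a b + z) (sym (ℤ.pos-* x a))) (trans (cong +_ eq) (ℤ.pos-* y b))))
    where
    lemma : ∀ g z → g ≡ - z + (g + z)
    lemma = solve-∀

  chinese-remainder : ∀ a b x z → x ≡ z mod gcd a b → ∃ λ y → x ≡ y mod a × y ≡ z mod b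
  chinese-remainder a b x z x≡z = y ,
    mod-intro x y (k * s) (lemma₁ x (k * s * + a)) , mod-intro y z (k * t) (begin
      x - k * s * + a - z                          ≡⟨ lemma₂ x (k * s * + a) z ⟩
      x - z - k * s * + a                          ≡⟨ cong (_- k * s * + a) (trans (ℤ._∣_.equality g∣) (cong (k *_) g≡)) ⟩
      k * (s * + a + t * + b) - k * s * + a        ≡⟨ lemma₃ k s t (+ a) (+ b) ⟩
      k * t * + b                                  ∎)
    where
    open ≡-Reasoning
    bez = Bézoutℤ a b
    s = Data.Product.proj₁ bez
    t = Data.Product.proj₁ (Data.Product.proj₂ bez)
    g≡ = Data.Product.proj₂ (Data.Product.proj₂ bez)
    g∣ : + gcd a b ∣ℤ x - z
    g∣ = ℤ.∣ᵤ⇒∣ x≡z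
    k = ℤ._∣_.quotient g∣
    -- With x - z = k g and g = s a + t b, moving x by -k s a leaves z + k t b.
    y = x - k * s * + a
    lemma₁ : ∀ x m → x - (x - m) ≡ m
    lemma₁ = solve-∀
    lemma₂ : ∀ x m z → x - m - z ≡ x - z - m
    lemma₂ = solve-∀
    lemma₃ : ∀ k s t a b → k * (s * a + t * b) - k * s * a ≡ k * t * b
    lemma₃ = solve-∀

  -- Averaging over aℤ and over bℤ averages over aℤ + bℤ = gcd(a,b)ℤ. If x and z agree modulo the
  -- gcd, the intermediate points form one class modulo the lcm, with N / lcm(a,b) members in the
  -- range, and a b = gcd(a,b) lcm(a,b).
  δ-convolution : ∀ {N} a b x z → a ℕ.∣ N → b ℕ.∣ N → .{{ℕ.NonZero N}} →
    sum {N} (λ i → (+ a * δ a x (+ toℕ i)) * (+ b * δ b (+ toℕ i) z)) ≡ + N * (+ gcd a b * δ (gcd a b) x z)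
  δ-convolution {N} a b x z a∣N b∣N = by-cases (gcd a b ℕ.∣? ∣ x - z ∣)
    where
    vanish : ¬ (x ≡ z mod gcd a b) → ∀ y (p : Dec (x ≡ y mod a)) (q : Dec (y ≡ z mod b)) → (+ a * 𝟙 p) * (+ b * 𝟙 q) ≡ + 0
    vanish x≢z y (yes x≡y) (yes y≡z) = contradiction
      (mod-trans x y z (ℕ.∣-trans (gcd[m,n]∣m a b) x≡y) (ℕ.∣-trans (gcd[m,n]∣n a b) y≡z)) x≢z
    vanish x≢z y (no _) q = trans (cong (_* (+ b * 𝟙 q)) (ℤ.*-zeroʳ (+ a))) (ℤ.*-zeroˡ (+ b * 𝟙 q))
    vanish x≢z y (yes _) (no _) = trans (cong (+ a * + 1 *_) (ℤ.*-zeroʳ (+ b))) (ℤ.*-zeroʳ (+ a * + 1))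
    lemma : ∀ n g → + 0 ≡ n * (g * + 0)
    lemma = solve-∀
    lemma₁ : ∀ a p b q → (a * p) * (b * q) ≡ a * b * (p * q)
    lemma₁ = solve-∀
    lemma₂ : ∀ g n → g * n ≡ n * (g * + 1)
    lemma₂ = solve-∀
    ab≡gl : + a * + b ≡ + gcd a b * + lcm a b
    ab≡gl = trans (sym (ℤ.pos-* a b)) (trans (cong +_ (sym (gcd*lcm a b))) (ℤ.pos-* (gcd a b) (lcm a b)))
    δδ : ∀ y₀ → x ≡ y₀ mod a → y₀ ≡ z mod b → ∀ y → δ a x y * δ b y z ≡ δ (lcm a b) y y₀
    δδ y₀ x≡y₀ y₀≡z y with a ℕ.∣? ∣ x - y ∣ | b ℕ.∣? ∣ y - z ∣
    ... | yes x≡y | yes y≡z = sym (𝟙-yes (lcm a b ℕ.∣? _) (lcm-least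
            (mod-trans y x y₀ (mod-sym x y x≡y) x≡y₀) (mod-trans y z y₀ y≡z (mod-sym y₀ z y₀≡z))))
    ... | yes _ | no y≢z = sym (𝟙-no (lcm a b ℕ.∣? _) (λ y≡y₀ →
            y≢z (mod-trans y y₀ z (ℕ.∣-trans (n∣lcm[m,n] a b) y≡y₀) y₀≡z)))
    ... | no x≢y | yes _ = sym (𝟙-no (lcm a b ℕ.∣? _) (λ y≡y₀ →
            x≢y (mod-trans x y₀ y x≡y₀ (mod-sym y y₀ (ℕ.∣-trans (m∣lcm[m,n] a b) y≡y₀)))))
    ... | no x≢y | no _ = sym (𝟙-no (lcm a b ℕ.∣? _) (λ y≡y₀ →
            x≢y (mod-trans x y₀ y x≡y₀ (mod-sym y y₀ (ℕ.∣-trans (m∣lcm[m,n] a b) y≡y₀)))))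
    Convolution : Dec (x ≡ z mod gcd a b) → Set
    Convolution x≡z? = sum {N} (λ i → (+ a * δ a x (+ toℕ i)) * (+ b * δ b (+ toℕ i) z)) ≡ + N * (+ gcd a b * 𝟙 x≡z?)
    solvable : ∀ y₀ → x ≡ y₀ mod a → y₀ ≡ z mod b → ∀ x≡z → Convolution (yes x≡z)
    solvable y₀ x≡y₀ y₀≡z _ = begin
      sum {N} (λ i → (+ a * δ a x (+ toℕ i)) * (+ b * δ b (+ toℕ i) z))
        ≡⟨ sum-cong-≋ {N} (λ i → trans (lemma₁ (+ a) (δ a x (+ toℕ i)) (+ b) (δ b (+ toℕ i) z)) (cong (+ a * + b *_) (δδ y₀ x≡y₀ y₀≡z (+ toℕ i)))) ⟩
      sum {N} (λ i → + a * + b * δ (lcm a b) (+ toℕ i) y₀)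
        ≡⟨ *-distribˡ-sum {N} (+ a * + b) (λ i → δ (lcm a b) (+ toℕ i) y₀) ⟨
      + a * + b * Σ< N (λ y → δ (lcm a b) (+ y) y₀)
        ≡⟨ cong (_* Σ< N (λ y → δ (lcm a b) (+ y) y₀)) ab≡gl ⟩
      + gcd a b * + lcm a b * Σ< N (λ y → δ (lcm a b) (+ y) y₀)
        ≡⟨ ℤ.*-assoc (+ gcd a b) (+ lcm a b) _ ⟩
      + gcd a b * (+ lcm a b * Σ< N (λ y → δ (lcm a b) (+ y) y₀))
        ≡⟨ cong (+ gcd a b *_) (residue-count (lcm a b) y₀ (lcm-least a∣N b∣N)) ⟩
      + gcd a b * + N
        ≡⟨ lemma₂ (+ gcd a b) (+ N) ⟩
      + N * (+ gcd a b * + 1) ∎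
      where open ≡-Reasoning
    by-cases : ∀ x≡z? → Convolution x≡z?
    by-cases (no x≢z) = trans (sum-zero {N} (λ i → vanish x≢z (+ toℕ i) (a ℕ.∣? ∣ x - + toℕ i ∣) (b ℕ.∣? ∣ + toℕ i - z ∣)))
                              (lemma (+ N) (+ gcd a b))
    by-cases (yes x≡z) = let (y₀ , x≡y₀ , y₀≡z) = chinese-remainder a b x z x≡z in solvable y₀ x≡y₀ y₀≡z x≡z

  -- Inclusion–exclusion over the moduli, for a valuation φ whose intersections are gcds.
  μ : (ℕ → ℤ) → List ℕ → ℤ
  μ φ []       = + 0
  μ φ (n ∷ ns) = φ n + (μ φ ns - μ (φ ∘ gcd n) ns)

  -- μ evaluates φ only at gcds of nonempty subfamilies of the moduli, and all of these satisfy this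
  -- predicate.
  DividesSome : List ℕ → ℕ → Set
  DividesSome ns m = Any (m ℕ.∣_) ns

  μ-cong : ∀ ns {φ ψ : ℕ → ℤ} → (∀ m → DividesSome ns m → φ m ≡ ψ m) → μ φ ns ≡ μ ψ ns
  μ-cong []       eq = refl
  μ-cong (n ∷ ns) eq = cong₂ _+_ (eq n (here ℕ.∣-refl)) (cong₂ _-_
    (μ-cong ns (λ m m∣ → eq m (there m∣)))
    (μ-cong ns (λ m _ → eq (gcd n m) (here (gcd[m,n]∣m n m)))))

  μ-zero : ∀ ns → μ (λ _ → + 0) ns ≡ + 0
  μ-zero []       = refl
  μ-zero (n ∷ ns) = cong₂ (λ a b → + 0 + (a - b)) (μ-zero ns) (μ-zero ns)

  μ-+ : ∀ ns (φ ψ : ℕ → ℤ) → μ (λ m → φ m + ψ m) ns ≡ μ φ ns + μ ψ ns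
  μ-+ []       φ ψ = refl
  μ-+ (n ∷ ns) φ ψ = trans
    (cong₂ (λ a b → φ n + ψ n + (a - b)) (μ-+ ns φ ψ) (μ-+ ns (φ ∘ gcd n) (ψ ∘ gcd n)))
    (lemma (φ n) (ψ n) (μ φ ns) (μ ψ ns) (μ (φ ∘ gcd n) ns) (μ (ψ ∘ gcd n) ns))
    where
    lemma : ∀ a b c d e f → a + b + ((c + d) - (e + f)) ≡ (a + (c - e)) + (b + (d - f))
    lemma = solve-∀

  μ-sum : ∀ ns {k} (φ : Fin k → ℕ → ℤ) → μ (λ m → sum (λ i → φ i m)) ns ≡ sum (λ i → μ (φ i) ns)
  μ-sum ns {zero}  φ = μ-zero ns
  μ-sum ns {suc k} φ = trans (μ-+ ns (φ zero) (λ m → sum (λ i → φ (suc i) m)))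
    (cong (λ z → μ (φ zero) ns + z) (μ-sum ns (φ ∘ suc)))

  μ-*ˡ : ∀ ns c (φ : ℕ → ℤ) → μ (λ m → c * φ m) ns ≡ c * μ φ ns
  μ-*ˡ []       c φ = sym (ℤ.*-zeroʳ c)
  μ-*ˡ (n ∷ ns) c φ = trans (cong₂ (λ a b → c * φ n + (a - b)) (μ-*ˡ ns c φ) (μ-*ˡ ns c (φ ∘ gcd n)))
    (lemma c (φ n) (μ φ ns) (μ (φ ∘ gcd n) ns))
    where
    lemma : ∀ c x y z → c * x + (c * y - c * z) ≡ c * (x + (y - z))
    lemma = solve-∀

  gcd-absorb : ∀ {m n} → m ℕ.∣ n → gcd m n ≡ m
  gcd-absorb {m} {n} m∣n = ℕ.∣-antisym (gcd[m,n]∣m m n) (gcd-greatest ℕ.∣-refl m∣n)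

  gcd-left-comm : ∀ m n k → gcd m (gcd n k) ≡ gcd n (gcd m k)
  gcd-left-comm m n k = trans (sym (gcd-assoc m n k)) (trans (cong (λ g → gcd g k) (gcd-comm m n)) (gcd-assoc n m k))

  -- Intersecting a union with a subset of one of its parts gives that subset back: in the inductive
  -- step the term at gcd(m,n) occurs once with each sign.
  μ-absorb : ∀ {ns m} (φ : ℕ → ℤ) → DividesSome ns m → μ (φ ∘ gcd m) ns ≡ φ m
  μ-absorb {n ∷ ns} {m} φ (here m∣n) = trans
    (cong₂ (λ a b → a + (μ (φ ∘ gcd m) ns - b)) (cong φ (gcd-absorb m∣n))
      (μ-cong ns (λ k _ → cong φ (trans (sym (gcd-assoc m n k)) (cong (λ g → gcd g k) (gcd-absorb m∣n))))))
    (lemma (φ m) (μ (φ ∘ gcd m) ns))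
    where
    lemma : ∀ a b → a + (b - b) ≡ a
    lemma = solve-∀
  μ-absorb {n ∷ ns} {m} φ (there m∣) = trans
    (cong₂ (λ a b → φ (gcd m n) + (a - b)) (μ-absorb φ m∣)
      (trans (μ-cong ns (λ k _ → cong φ (gcd-left-comm m n k)))
        (trans (μ-absorb (φ ∘ gcd n) m∣) (cong φ (gcd-comm n m)))))
    (lemma (φ (gcd m n)) (φ m))
    where
    lemma : ∀ a b → a + (b - a) ≡ b
    lemma = solve-∀

  -- The orthogonal projection, scaled by N, onto the sum of the spaces of n-periodic functions on
  -- {0, …, N - 1}, for n in ns.
  module PeriodicProjection {N} .{{_ : ℕ.NonZero N}} {ns} (ns∣N : All (ℕ._∣ N) ns) where

    averaging : ℕ → Fin N → Fin N → ℤ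
    averaging m i j = + m * δ m (+ toℕ i) (+ toℕ j)

    projection : Fin N → Fin N → ℤ
    projection i j = μ (λ m → averaging m i j) ns

    rank : ℤ
    rank = μ (λ m → + m) ns

    divides-N : ∀ {ns m} → All (ℕ._∣ N) ns → DividesSome ns m → m ℕ.∣ N
    divides-N (n∣N ∷ _)   (here m∣n) = ℕ.∣-trans m∣n n∣N
    divides-N (_ ∷ ns∣N)  (there m∣) = divides-N ns∣N m∣

    -- Composition with `averaging m` turns each `averaging k` into N times `averaging (gcd m k)`,
    -- and `μ-absorb` collapses the inclusion-exclusion sum. Idempotence follows, the projection
    -- being a combination of such operators.
    projection*averaging : ∀ {m} → DividesSome ns m → ∀ i j →
      sum (λ l → projection i l * averaging m l j) ≡ + N * averaging m i j
    projection*averaging {m} m∣ i j = begin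
      sum (λ l → projection i l * averaging m l j)
        ≡⟨ sum-cong-≋ (λ l → trans (ℤ.*-comm (projection i l) (averaging m l j))
             (sym (μ-*ˡ ns (averaging m l j) (λ k → averaging k i l)))) ⟩
      sum (λ l → μ (λ k → averaging m l j * averaging k i l) ns)
        ≡⟨ μ-sum ns (λ l k → averaging m l j * averaging k i l) ⟨
      μ (λ k → sum (λ l → averaging m l j * averaging k i l)) ns
        ≡⟨ μ-cong ns (λ k k∣ → trans (sum-cong-≋ (λ l → ℤ.*-comm (averaging m l j) (averaging k i l)))
             (trans (δ-convolution k m (+ toℕ i) (+ toℕ j) (divides-N ns∣N k∣) (divides-N ns∣N m∣))
               (cong (λ g → + N * averaging g i j) (gcd-comm k m)))) ⟩
      μ (λ k → + N * averaging (gcd m k) i j) ns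
        ≡⟨ μ-*ˡ ns (+ N) (λ k → averaging (gcd m k) i j) ⟩
      + N * μ (λ k → averaging (gcd m k) i j) ns
        ≡⟨ cong (+ N *_) (μ-absorb (λ k → averaging k i j) m∣) ⟩
      + N * averaging m i j ∎
      where open ≡-Reasoning

    N≢0 : + N ≢ + 0
    N≢0 eq = ℕ.≢-nonZero⁻¹ N (ℤ.+-injective eq)

    isScaledProjection : ScaledProjection projection (+ N) rank
    isScaledProjection = record
      { s≢0 = N≢0
      ; idempotent = λ i j → begin
          sum (λ l → projection i l * projection l j)
            ≡⟨ sum-cong-≋ (λ l → sym (μ-*ˡ ns (projection i l) (λ m → averaging m l j))) ⟩
          sum (λ l → μ (λ m → projection i l * averaging m l j) ns)
            ≡⟨ μ-sum ns (λ l m → projection i l * averaging m l j) ⟨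
          μ (λ m → sum (λ l → projection i l * averaging m l j)) ns
            ≡⟨ μ-cong ns (λ m m∣ → projection*averaging m∣ i j) ⟩
          μ (λ m → + N * averaging m i j) ns
            ≡⟨ μ-*ˡ ns (+ N) (λ m → averaging m i j) ⟩
          + N * projection i j ∎
      ; trace = begin
          sum (λ i → projection i i)
            ≡⟨ μ-sum ns (λ i m → averaging m i i) ⟨
          μ (λ m → sum (λ i → averaging m i i)) ns
            ≡⟨ μ-cong ns (λ m _ → trans (sum-cong-≋ {N} (λ i → trans
                 (cong (+ m *_) (𝟙-yes (m ℕ.∣? ∣ + toℕ i - + toℕ i ∣) (mod-refl {m} (+ toℕ i)))) (ℤ.*-identityʳ (+ m))))
                 (sum-const N (+ m))) ⟩
          μ (λ m → + N * + m) ns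
            ≡⟨ μ-*ˡ ns (+ N) (λ m → + m) ⟩
          + N * rank ∎
      }
      where open ≡-Reasoning

    -- Up to the factor N, a periodic w is its own average, and the projection absorbs the
    -- averaging. An extra N is introduced and cancelled to stay in ℤ.
    fixes-periodic : ∀ {n} → DividesSome ns n → (w : ℕ → ℤ) →
      (∀ x y → + x ≡ + y mod n → w x ≡ w y) → Fixes projection (+ N) (λ i → w (toℕ i))
    fixes-periodic {n} n∣ w periodic i = ℤ.*-cancelˡ-≡ (+ N) _ _ (begin
      + N * sum (λ j → projection i j * w (toℕ j))
        ≡⟨ *-distribˡ-sum (+ N) (λ j → projection i j * w (toℕ j)) ⟩
      sum (λ j → + N * (projection i j * w (toℕ j)))
        ≡⟨ sum-cong-≋ (λ j → trans (lemma (+ N) (projection i j) (w (toℕ j))) (cong (projection i j *_) (sym (average j)))) ⟩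
      sum (λ j → projection i j * sum (λ l → averaging n j l * w (toℕ l)))
        ≡⟨ sum-cong-≋ (λ j → *-distribˡ-sum (projection i j) (λ l → averaging n j l * w (toℕ l))) ⟩
      sum (λ j → sum (λ l → projection i j * (averaging n j l * w (toℕ l))))
        ≡⟨ ∑-comm (λ j l → projection i j * (averaging n j l * w (toℕ l))) ⟩
      sum (λ l → sum (λ j → projection i j * (averaging n j l * w (toℕ l))))
        ≡⟨ sum-cong-≋ (λ l → trans
             (sum-cong-≋ (λ j → sym (ℤ.*-assoc (projection i j) (averaging n j l) (w (toℕ l)))))
             (trans (sym (*-distribʳ-sum (w (toℕ l)) (λ j → projection i j * averaging n j l)))
               (trans (cong (_* w (toℕ l)) (projection*averaging n∣ i l)) (ℤ.*-assoc (+ N) (averaging n i l) (w (toℕ l)))))) ⟩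
      sum (λ l → + N * (averaging n i l * w (toℕ l)))
        ≡⟨ *-distribˡ-sum (+ N) (λ l → averaging n i l * w (toℕ l)) ⟨
      + N * sum (λ l → averaging n i l * w (toℕ l))
        ≡⟨ cong (+ N *_) (average i) ⟩
      + N * (+ N * w (toℕ i)) ∎)
      where
      open ≡-Reasoning
      lemma : ∀ a b c → a * (b * c) ≡ b * (a * c)
      lemma = solve-∀
      lemma₂ : ∀ a b c → a * (b * c) ≡ (a * c) * b
      lemma₂ = solve-∀
      replace : ∀ x y (x≡y? : Dec (+ x ≡ + y mod n)) → 𝟙 x≡y? * w y ≡ 𝟙 x≡y? * w x
      replace x y (yes x≡y) = cong (+ 1 *_) (sym (periodic x y x≡y))
      replace x y (no _)    = refl
      average : ∀ j → sum (λ l → averaging n j l * w (toℕ l)) ≡ + N * w (toℕ j)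
      average j = begin
        sum (λ l → averaging n j l * w (toℕ l))
          ≡⟨ sum-cong-≋ {N} (λ l → trans (ℤ.*-assoc (+ n) (δ n (+ toℕ j) (+ toℕ l)) (w (toℕ l)))
               (trans (cong (+ n *_) (replace (toℕ j) (toℕ l) (n ℕ.∣? ∣ + toℕ j - + toℕ l ∣)))
                 (trans (lemma₂ (+ n) (δ n (+ toℕ j) (+ toℕ l)) (w (toℕ j)))
                   (cong (+ n * w (toℕ j) *_) (𝟙-cong (n ℕ.∣? ∣ + toℕ j - + toℕ l ∣) (n ℕ.∣? ∣ + toℕ l - + toℕ j ∣)
                     (mod-sym (+ toℕ j) (+ toℕ l)) (mod-sym (+ toℕ l) (+ toℕ j))))))) ⟩
        sum {N} (λ l → + n * w (toℕ j) * δ n (+ toℕ l) (+ toℕ j))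
          ≡⟨ *-distribˡ-sum {N} (+ n * w (toℕ j)) (λ l → δ n (+ toℕ l) (+ toℕ j)) ⟨
        + n * w (toℕ j) * Σ< N (λ l → δ n (+ l) (+ toℕ j))
          ≡⟨ lemma₃ (+ n) (w (toℕ j)) _ ⟩
        + n * Σ< N (λ l → δ n (+ l) (+ toℕ j)) * w (toℕ j)
          ≡⟨ cong (_* w (toℕ j)) (residue-count n (+ toℕ j) (divides-N ns∣N n∣)) ⟩
        + N * w (toℕ j) ∎
        where
        lemma₃ : ∀ a b c → a * b * c ≡ a * c * b
        lemma₃ = solve-∀

  -- r / N = s / n for some 0 ≤ s < n exactly when N ∣ r n.
  module _ {N} .{{_ : ℕ.NonZero N}} where

    N∣r*? : ∀ r m → Dec (N ℕ.∣ r ℕ.* m)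
    N∣r*? r m = N ℕ.∣? r ℕ.* m

    FractionOf : List ℕ → ℕ → Set
    FractionOf ns r = Any (λ n → N ℕ.∣ r ℕ.* n) ns

    fractionOf? : ∀ ns r → Dec (FractionOf ns r)
    fractionOf? ns r = Any.any? (N∣r*? r) ns

    -- N divides r gcd(n,m) exactly when it divides both r n and r m. So gcds act as intersections
    -- of the sets of such r, and inclusion-exclusion yields the indicator of their union.
    μ-indicator : ∀ r ns → μ (λ m → 𝟙 (N∣r*? r m)) ns ≡ 𝟙 (fractionOf? ns r)
    μ-indicator r [] = refl
    μ-indicator r (n ∷ ns) = by-cases (N∣r*? r n)
      where
      lemma₁ : ∀ b → + 1 + (b - b) ≡ + 1
      lemma₁ = solve-∀
      lemma₂ : ∀ b → + 0 + (b - + 0) ≡ b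
      lemma₂ = solve-∀
      φ : ℕ → ℤ
      φ m = 𝟙 (N∣r*? r m)
      by-cases : (N∣rn? : Dec (N ℕ.∣ r ℕ.* n)) → 𝟙 N∣rn? + (μ φ ns - μ (φ ∘ gcd n) ns) ≡ 𝟙 (fractionOf? (n ∷ ns) r)
      by-cases (yes N∣rn) = trans
        (cong (λ a → + 1 + (μ φ ns - a)) (μ-cong ns (λ m _ → 𝟙-cong (N∣r*? r (gcd n m)) (N∣r*? r m)
          (λ N∣ → ℕ.∣-trans N∣ (ℕ.*-monoʳ-∣ r (gcd[m,n]∣n n m)))
          (λ N∣ → subst (N ℕ.∣_) (sym (c*gcd[m,n]≡gcd[cm,cn] r n m)) (gcd-greatest N∣rn N∣)))))
        (trans (lemma₁ (μ φ ns)) (sym (𝟙-yes (fractionOf? (n ∷ ns) r) (here N∣rn))))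
      by-cases (no N∤rn) = trans
        (cong₂ (λ a b → + 0 + (a - b)) (μ-indicator r ns)
          (trans (μ-cong ns (λ m _ → 𝟙-no (N∣r*? r (gcd n m)) (λ N∣ → N∤rn (ℕ.∣-trans N∣ (ℕ.*-monoʳ-∣ r (gcd[m,n]∣m n m))))))
            (μ-zero ns)))
        (trans (lemma₂ (𝟙 (fractionOf? ns r)))
          (𝟙-cong (fractionOf? ns r) (fractionOf? (n ∷ ns) r) there (Any.tail N∤rn)))

    -- With N = q m, the condition N ∣ r m says q ∣ r, and there are m multiples of q below N.
    modulus-count : ∀ {m} → m ℕ.∣ N → Σ< N (λ r → 𝟙 (N∣r*? r m)) ≡ + m
    modulus-count {m} m∣N@(ℕ.divides q N≡qm) = ℤ.*-cancelˡ-≡ (+ q) _ _ {{q≢0}} (begin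
      + q * Σ< N (λ r → 𝟙 (N∣r*? r m))
        ≡⟨ cong (+ q *_) (Σ<-cong N (λ r _ → 𝟙-cong (N∣r*? r m) (q ℕ.∣? ∣ + r - + 0 ∣)
             (λ N∣ → subst (q ℕ.∣_) (sym (∣r-0∣ r)) (ℕ.*-cancelʳ-∣ m {{m≢0}} (subst (ℕ._∣ r ℕ.* m) N≡qm N∣)))
             (λ q∣ → subst (ℕ._∣ r ℕ.* m) (sym N≡qm) (ℕ.*-monoˡ-∣ m (subst (q ℕ.∣_) (∣r-0∣ r) q∣))))) ⟩
      + q * Σ< N (λ r → δ q (+ r) (+ 0))
        ≡⟨ residue-count q (+ 0) (ℕ.divides m (trans N≡qm (ℕ.*-comm q m))) ⟩
      + N
        ≡⟨ cong +_ N≡qm ⟩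
      + (q ℕ.* m)
        ≡⟨ ℤ.pos-* q m ⟩
      + q * + m ∎)
      where
      open ≡-Reasoning
      ∣r-0∣ : ∀ r → ∣ + r - + 0 ∣ ≡ r
      ∣r-0∣ r = cong ∣_∣ (ℤ.+-identityʳ (+ r))
      qm≢0 : ℕ.NonZero (q ℕ.* m)
      qm≢0 = subst ℕ.NonZero N≡qm (ℕ.≢-nonZero (ℕ.≢-nonZero⁻¹ N))
      q≢0 : ℕ.NonZero q
      q≢0 = ℕ.m*n≢0⇒m≢0 q {{qm≢0}}
      m≢0 : ℕ.NonZero m
      m≢0 = ℕ.m*n≢0⇒n≢0 q {{qm≢0}}

    -- Replacing m by the number of r < N with N ∣ r m and exchanging sums turns the trace, an
    -- alternating sum of gcds, into a plain count of fractions r / N.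
    rank-count : ∀ {ns} → All (ℕ._∣ N) ns → μ (λ m → + m) ns ≡ Σ< N (λ r → 𝟙 (fractionOf? ns r))
    rank-count {ns} ns∣N = begin
      μ (λ m → + m) ns
        ≡⟨ μ-cong ns (λ m m∣ → modulus-count (PeriodicProjection.divides-N ns∣N ns∣N m∣)) ⟨
      μ (λ m → Σ< N (λ r → 𝟙 (N∣r*? r m))) ns
        ≡⟨ μ-sum ns {N} (λ r m → 𝟙 (N∣r*? (toℕ r) m)) ⟩
      sum {N} (λ r → μ (λ m → 𝟙 (N∣r*? (toℕ r) m)) ns)
        ≡⟨ sum-cong-≋ {N} (λ r → μ-indicator (toℕ r) ns) ⟩
      Σ< N (λ r → 𝟙 (fractionOf? ns r)) ∎
      where open ≡-Reasoning

  -- Counting the fractions in S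

  module _ {a p} {A : Set a} {P : A → Set p} (P? : Decidable P) where

    length-filter-∷ : ∀ x xs → + length (filter P? (x ∷ xs)) ≡ 𝟙 (P? x) ℤ.+ + length (filter P? xs)
    length-filter-∷ x xs with P? x
    ... | yes _ = refl
    ... | no _  = refl

  Σ<-𝟙 : ∀ {a p} {A : Set a} {P : A → Set p} (P? : Decidable P) n (f : ℕ → A) →
    Σ< n (λ r → 𝟙 (P? (f r))) ≡ + length (filter P? (applyUpTo f n))
  Σ<-𝟙 P? zero    f = refl
  Σ<-𝟙 P? (suc n) f = trans (cong (λ z → 𝟙 (P? (f 0)) ℤ.+ z) (Σ<-𝟙 P? n (f ∘ suc)))
    (sym (length-filter-∷ P? (f 0) (applyUpTo (f ∘ suc) n)))

  module _ {a} {A : Set a} where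

    lookup-injective : ∀ {xs : List A} → Unique xs → ∀ i j → lookup xs i ≡ lookup xs j → i ≡ j
    lookup-injective (_ ∷ _)    Fin.zero    Fin.zero    _  = refl
    lookup-injective (x∉ ∷ _)   Fin.zero    (Fin.suc j) eq = contradiction eq (All.lookup x∉ (∈-lookup j))
    lookup-injective (x∉ ∷ _)   (Fin.suc i) Fin.zero    eq = contradiction (sym eq) (All.lookup x∉ (∈-lookup i))
    lookup-injective (_ ∷ uniq) (Fin.suc i) (Fin.suc j) eq = cong Fin.suc (lookup-injective uniq i j eq)

    length-⊆ : ∀ {xs ys : List A} → Unique xs → (∀ {x} → x ∈ xs → x ∈ ys) → length xs ℕ.≤ length ys
    length-⊆ {xs} {ys} uniq xs⊆ys = Fin.injective⇒≤ {f = λ i → Any.index (xs⊆ys (∈-lookup i))} λ {i} {j} eq →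
      lookup-injective uniq i j (trans (Any.lookup-index (xs⊆ys (∈-lookup i)))
        (trans (cong (lookup ys) eq) (sym (Any.lookup-index (xs⊆ys (∈-lookup j))))))

  /-cross : ∀ r m s n .{{_ : ℕ.NonZero m}} .{{_ : ℕ.NonZero n}} → r ℕ.* n ≡ s ℕ.* m → + r ℚ./ m ≡ + s ℚ./ n
  /-cross r m@(suc m-1) s n@(suc n-1) eq = ℚ.fromℚᵘ-cong {ℚᵘ.mkℚᵘ (+ r) m-1} {ℚᵘ.mkℚᵘ (+ s) n-1}
    (ℚᵘ.*≡* (trans (sym (ℤ.pos-* r n)) (trans (cong +_ eq) (ℤ.pos-* s m))))

  /-injective : ∀ n .{{_ : ℕ.NonZero n}} {r s} → + r ℚ./ n ≡ + s ℚ./ n → r ≡ s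
  /-injective n@(suc n-1) {r} {s} eq
    with ℚ.fromℚᵘ-injective {ℚᵘ.mkℚᵘ (+ r) n-1} {ℚᵘ.mkℚᵘ (+ s) n-1} eq
  ... | ℚᵘ.*≡* rn≡sn = ℤ.+-injective (ℤ.*-cancelʳ-≡ (+ r) (+ s) (+ n) rn≡sn)

  distinctFractions : List ℕ → List ℚ
  distinctFractions ns = deduplicate ℚ._≟_ (concatMap fractions ns)

  -- The n fractions r / n are distinct members of the list. Through this bound every modulus is
  -- smaller than p, hence prime to p.
  modulus≤ : ∀ {n ns} → n ∈ ns → n ℕ.≤ length (distinctFractions ns)
  modulus≤ {zero}  _    = ℕ.z≤n
  modulus≤ {n@(suc n-1)} {ns} n∈ns = subst (ℕ._≤ length (distinctFractions ns))
    (trans (length-map _ (upTo n)) (length-upTo n))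
    (length-⊆ (Unique.map⁺ (/-injective n) (Unique.upTo⁺ n))
      (λ x∈ → ∈-deduplicate⁺ ℚ._≟_ (∈-concatMap⁺ fractions (Any.map (λ { refl → x∈ }) n∈ns))))

  ∈-fractions : ∀ {N} .{{_ : ℕ.NonZero N}} {n r} → n ℕ.∣ N → r ℕ.< N → N ℕ.∣ r ℕ.* n → + r ℚ./ N ∈ fractions n
  ∈-fractions {N} {zero} 0∣N _ _ = contradiction (ℕ.0∣⇒≡0 0∣N) (ℕ.≢-nonZero⁻¹ N)
  ∈-fractions {N} {n@(suc _)} {r} _ r<N (ℕ.divides s rn≡sN) = subst (_∈ fractions n) (sym (/-cross r N s n rn≡sN))
    (∈-map⁺ (λ s → + s ℚ./ n) (∈-upTo⁺ (ℕ.*-cancelʳ-< N s n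
      (subst₂ ℕ._<_ rn≡sN (ℕ.*-comm N n) (ℕ.*-monoˡ-< n r<N)))))

  -- The map r ↦ r / N embeds the residues counted by `rank-count` into the list of distinct
  -- fractions.
  rank≤ : ∀ {N} .{{_ : ℕ.NonZero N}} {ns} → All (ℕ._∣ N) ns → μ (λ m → + m) ns ℤ.≤ + length (distinctFractions ns)
  rank≤ {N} {ns} ns∣N = subst (ℤ._≤ + length (distinctFractions ns))
    (sym (trans (rank-count ns∣N) (Σ<-𝟙 (fractionOf? ns) N id)))
    (ℤ.+≤+ (subst (ℕ._≤ length (distinctFractions ns)) (length-map (λ r → + r ℚ./ N) rs)
      (length-⊆ (Unique.map⁺ (/-injective N) (Unique.filter⁺ (fractionOf? ns) (Unique.upTo⁺ N))) fraction∈)))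
    where
    rs = filter (fractionOf? ns) (upTo N)
    any-all : ∀ {ns r} → All (ℕ._∣ N) ns → r ℕ.< N → FractionOf ns r → Any (λ n → + r ℚ./ N ∈ fractions n) ns
    any-all (n∣N ∷ _)  r<N (here N∣rn) = here (∈-fractions n∣N r<N N∣rn)
    any-all (_ ∷ ns∣N) r<N (there any) = there (any-all ns∣N r<N any)
    fraction∈ : ∀ {x} → x ∈ map (λ r → + r ℚ./ N) rs → x ∈ distinctFractions ns
    fraction∈ x∈ with ∈-map⁻ (λ r → + r ℚ./ N) x∈
    ... | r , r∈rs , refl = let (r∈ , frac) = ∈-filter⁻ (fractionOf? ns) {xs = upTo N} r∈rs in
      ∈-deduplicate⁺ ℚ._≟_ (∈-concatMap⁺ fractions (any-all ns∣N (∈-upTo⁻ r∈) frac))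

-- Generating functions

-- The product of power series.
infixr 7 _⊛_
_⊛_ : (ℕ → ℤ) → (ℕ → ℤ) → ℕ → ℤ
(d ⊛ f) zero    = d 0 ℤ.* f 0
(d ⊛ f) (suc m) = d 0 ℤ.* f (suc m) ℤ.+ ((d ∘ suc) ⊛ f) m

⊛-zeroˡ : ∀ d f m → (∀ i → d i ≡ + 0) → (d ⊛ f) m ≡ + 0
⊛-zeroˡ d f zero    d≡0 = ≡.trans (≡.cong (ℤ._* f 0) (d≡0 0)) (ℤ.*-zeroˡ (f 0))
⊛-zeroˡ d f (suc m) d≡0 = ≡.cong₂ ℤ._+_ (≡.trans (≡.cong (ℤ._* f (suc m)) (d≡0 0)) (ℤ.*-zeroˡ (f (suc m))))
  (⊛-zeroˡ (d ∘ suc) f m (d≡0 ∘ suc))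

⊛-zeroʳ : ∀ d f m → (∀ i → i ≤ m → f i ≡ + 0) → (d ⊛ f) m ≡ + 0
⊛-zeroʳ d f zero    f≡0 = ≡.trans (≡.cong (d 0 ℤ.*_) (f≡0 0 z≤n)) (ℤ.*-zeroʳ (d 0))
⊛-zeroʳ d f (suc m) f≡0 = ≡.cong₂ ℤ._+_ (≡.trans (≡.cong (d 0 ℤ.*_) (f≡0 (suc m) ℕ.≤-refl)) (ℤ.*-zeroʳ (d 0)))
  (⊛-zeroʳ (d ∘ suc) f m (λ i i≤m → f≡0 i (ℕ.m≤n⇒m≤1+n i≤m)))

-- Power series over ℤ have no zero divisors: leading zeros of d are stripped until d 0 is nonzero,
-- and then the values of f vanish one after another by strong induction.
⊛≡0⇒≡0 : ∀ j d f → d j ≢ + 0 → (∀ m → (d ⊛ f) m ≡ + 0) → ∀ x → f x ≡ + 0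
⊛≡0⇒≡0 j d f dj≢0 df≡0 with d 0 ℤ.≟ + 0
⊛≡0⇒≡0 zero d f dj≢0 df≡0 | yes d0≡0 = contradiction d0≡0 dj≢0
⊛≡0⇒≡0 (suc j) d f dj≢0 df≡0 | yes d0≡0 = ⊛≡0⇒≡0 j (d ∘ suc) f dj≢0 (λ m → ≡.trans
  (≡.sym (≡.trans (≡.cong (λ z → z ℤ.* f (suc m) ℤ.+ ((d ∘ suc) ⊛ f) m) d0≡0)
    (≡.trans (≡.cong (ℤ._+ ((d ∘ suc) ⊛ f) m) (ℤ.*-zeroˡ (f (suc m)))) (ℤ.+-identityˡ _)))) (df≡0 (suc m)))
... | no d0≢0 = λ x → below (suc x) x ℕ.≤-refl
  where
  next : ∀ x → (∀ i → i < x → f i ≡ + 0) → f x ≡ + 0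
  next zero    _   = i*j≡0⇒j≡0 d0≢0 (df≡0 0)
  next (suc x) f≡0 = i*j≡0⇒j≡0 d0≢0 (≡.trans (≡.sym (≡.trans
    (≡.cong (λ z → d 0 ℤ.* f (suc x) ℤ.+ z) (⊛-zeroʳ (d ∘ suc) f x (λ i i≤x → f≡0 i (s≤s i≤x))))
    (ℤ.+-identityʳ _))) (df≡0 (suc x)))
  below : ∀ n x → x < n → f x ≡ + 0
  below (suc n) x (s≤s x≤n) = next x (λ i i<x → below n i (ℕ.<-≤-trans i<x x≤n))

extend : ∀ {n} → (Fin n → ℤ) → ℕ → ℤ
extend {zero}  a _       = + 0
extend {suc n} a zero    = a zero
extend {suc n} a (suc i) = extend (a ∘ suc) i

extend-toℕ : ∀ {n} (a : Fin n → ℤ) i → extend a (toℕ i) ≡ a i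
extend-toℕ a zero    = ≡.refl
extend-toℕ a (suc i) = extend-toℕ (a ∘ suc) i

extend-≥ : ∀ {n} (a : Fin n → ℤ) i → n ≤ i → extend a i ≡ + 0
extend-≥ {zero}  a i       _         = ≡.refl
extend-≥ {suc n} a (suc i) (s≤s n≤i) = extend-≥ (a ∘ suc) i n≤i

-- The coefficient of z^(M+x) in d f when d has degree at most M, arranged as a combination of the
-- shifts of f evaluated at x.
recurrence : (ℕ → ℤ) → (ℕ → ℤ) → ℕ → ℕ → ℤ
recurrence d f M x = ℤ-Sum.Σ< (suc M) (λ i → d i ℤ.* f (x ℕ.+ (M ∸ i)))

⊛-recurrence : ∀ d f M x → (∀ i → M < i → d i ≡ + 0) → (d ⊛ f) (M ℕ.+ x) ≡ recurrence d f M x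
⊛-recurrence d f zero zero d≡0 = ≡.sym (ℤ.+-identityʳ _)
⊛-recurrence d f zero (suc x) d≡0 = ≡.cong₂ ℤ._+_ (≡.cong (λ y → d 0 ℤ.* f y) (≡.sym (ℕ.+-identityʳ (suc x))))
  (⊛-zeroˡ (d ∘ suc) f x (λ i → d≡0 (suc i) (s≤s z≤n)))
⊛-recurrence d f (suc M) x d≡0 = ≡.cong₂ ℤ._+_ (≡.cong (λ y → d 0 ℤ.* f y) (ℕ.+-comm (suc M) x))
  (⊛-recurrence (d ∘ suc) f M x (λ i M<i → d≡0 (suc i) (s≤s M<i)))

-- Covering functions as sums of periodic functions

covering-∷ : ∀ a n A x → + covering ((a , n) ∷ A) x ≡ δ n x (+ a) ℤ.+ + covering A x
covering-∷ a n A x = length-filter-∷ (λ c → proj₂ c ℕ.∣? ∣ x ℤ.- + proj₁ c ∣) (a , n) A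

covering-periodic : ∀ {N} A → All (ℕ._∣ N) (moduli A) → ∀ x y → x ≡ y mod N → + covering A x ≡ + covering A y
covering-periodic []            _           x y x≡y = ≡.refl
covering-periodic ((a , n) ∷ A) (n∣N ∷ A∣N) x y x≡y = begin
  + covering ((a , n) ∷ A) x          ≡⟨ covering-∷ a n A x ⟩
  δ n x (+ a) ℤ.+ + covering A x      ≡⟨ ≡.cong₂ ℤ._+_ (δ-congˡ n x y (+ a) (ℕ.∣-trans n∣N x≡y)) (covering-periodic A A∣N x y x≡y) ⟩
  δ n y (+ a) ℤ.+ + covering A y      ≡⟨ covering-∷ a n A y ⟨
  + covering ((a , n) ∷ A) y          ∎
  where open ≡.≡-Reasoning

module _ {N} .{{_ : ℕ.NonZero N}} {ns} (ns∣N : All (ℕ._∣ N) ns) where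
  open PeriodicProjection ns∣N

  -- A shift by s preserves the period of each summand, so the same projection fixes all shifts of a
  -- covering function.
  covering-fixed : ∀ A → (∀ {n} → n ∈ moduli A → n ∈ ns) → ∀ s →
    Fixes projection (+ N) (λ i → + covering A (+ (toℕ i ℕ.+ s)))
  covering-fixed [] _ s i = ≡.trans (ℤ-Sum.sum-zero (λ j → ℤ.*-zeroʳ (projection i j))) (≡.sym (ℤ.*-zeroʳ (+ N)))
  covering-fixed ((a , n) ∷ A) A⊆ns s i = ≡.trans
    (ℤ-Sum.sum-cong-≋ (λ j → ≡.cong (projection i j ℤ.*_) (split j)))
    (≡.trans (Fixes-linear projection {+ N} (+ 1) (+ 1) {λ i → δ n (+ (toℕ i ℕ.+ s)) (+ a)} {λ i → + covering A (+ (toℕ i ℕ.+ s))}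
        (fixes-periodic (Any.map (λ { ≡.refl → ℕ.∣-refl }) (A⊆ns (here ≡.refl))) (λ x → δ n (+ (x ℕ.+ s)) (+ a)) periodic)
        (covering-fixed A (A⊆ns ∘ there) s) i)
      (≡.cong (+ N ℤ.*_) (≡.sym (split i))))
    where
    lemma : ∀ x y → x ℤ.+ y ≡ + 1 ℤ.* x ℤ.+ + 1 ℤ.* y
    lemma = solve-∀
    split : ∀ (i : Fin N) → + covering ((a , n) ∷ A) (+ (toℕ i ℕ.+ s)) ≡
      + 1 ℤ.* δ n (+ (toℕ i ℕ.+ s)) (+ a) ℤ.+ + 1 ℤ.* + covering A (+ (toℕ i ℕ.+ s))
    split i = ≡.trans (covering-∷ a n A (+ (toℕ i ℕ.+ s))) (lemma (δ n (+ (toℕ i ℕ.+ s)) (+ a)) (+ covering A (+ (toℕ i ℕ.+ s))))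
    periodic : ∀ x y → + x ≡ + y mod n → δ n (+ (x ℕ.+ s)) (+ a) ≡ δ n (+ (y ℕ.+ s)) (+ a)
    periodic x y x≡y = δ-congˡ n (+ (x ℕ.+ s)) (+ (y ℕ.+ s)) (+ a) (mod-+ʳ x y s x≡y)

-- Generating functions evaluated at ζ

module GeneratingFunctions {c ℓ} (F : Field c ℓ) (char0 : CharZero F)
  {q} (p-prime : Prime (suc (suc q))) {ζ} (ζ-prim : PrimitiveRoot F (suc (suc q)) ζ) where
  open Field F hiding (zero)
  open FieldLemmas F char0
  open CyclotomicIntegers F char0 p-prime ζ-prim using (p; eval-suc; eval-linear; linearly-independent; 1^)
  open import Algebra.Properties.Semiring.Exp semiring using (^-homo-*; ^-congˡ; ^-assocʳ)
  open import Relation.Binary.Reasoning.Setoid setoid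
  open Solver using (solve; _:=_; _:+_; _:*_; _:-_; :-_; con)

  ζ^≈1⇒p∣ : ∀ n → ζ ^ n ≈ 1# → p ℕ.∣ n
  ζ^≈1⇒p∣ n ζ^n≈1 = by-remainder (n ℕ.% p) ≡.refl
    where
    ζ^n%p≈1 : ζ ^ (n ℕ.% p) ≈ 1#
    ζ^n%p≈1 = begin
      ζ ^ (n ℕ.% p)                                ≈⟨ *-identityʳ _ ⟨
      ζ ^ (n ℕ.% p) * 1#                           ≈⟨ *-congˡ (1^ (n ℕ./ p)) ⟨
      ζ ^ (n ℕ.% p) * 1# ^ (n ℕ./ p)               ≈⟨ *-congˡ (^-congˡ (n ℕ./ p) (proj₁ ζ-prim)) ⟨
      ζ ^ (n ℕ.% p) * (ζ ^ p) ^ (n ℕ./ p)          ≈⟨ *-congˡ (^-assocʳ ζ p (n ℕ./ p)) ⟩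
      ζ ^ (n ℕ.% p) * ζ ^ (p ℕ.* (n ℕ./ p))        ≈⟨ ^-homo-* ζ (n ℕ.% p) (p ℕ.* (n ℕ./ p)) ⟨
      ζ ^ (n ℕ.% p ℕ.+ p ℕ.* (n ℕ./ p))            ≡⟨ ≡.cong (λ k → ζ ^ (n ℕ.% p ℕ.+ k)) (ℕ.*-comm p (n ℕ./ p)) ⟩
      ζ ^ (n ℕ.% p ℕ.+ n ℕ./ p ℕ.* p)              ≡⟨ ≡.cong (ζ ^_) (ℕ.m≡m%n+[m/n]*n n p) ⟨
      ζ ^ n                                        ≈⟨ ζ^n≈1 ⟩
      1#                                           ∎
    by-remainder : ∀ r → n ℕ.% p ≡ r → p ℕ.∣ n
    by-remainder zero    n%p≡0 = ℕ.m%n≡0⇒n∣m n p n%p≡0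
    by-remainder (suc r) n%p≡r = contradiction (≡.subst (λ r → ζ ^ r ≈ 1#) n%p≡r ζ^n%p≈1)
      (proj₂ ζ-prim (suc r) (s≤s z≤n) (≡.subst (_< p) n%p≡r (ℕ.m%n<n n p)))

  1-ζ^≉0 : ∀ {n} → ¬ (p ℕ.∣ n) → ¬ (1# - ζ ^ n ≈ 0#)
  1-ζ^≉0 {n} p∤n eq = p∤n (ζ^≈1⇒p∣ n (sym (x∙y⁻¹≈ε⇒x≈y 1# (ζ ^ n) eq)))

  gen : ℕ → (ℕ → ℤ) → Carrier
  gen N f = Σ< N (λ x → ι (f x) * ζ ^ x)

  gen-cong : ∀ N {f g} → (∀ x → x < N → f x ≡ g x) → gen N f ≈ gen N g
  gen-cong N eq = Σ<-cong N (λ x x<N → *-congʳ {ζ ^ x} (reflexive (≡.cong ι (eq x x<N))))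

  gen-suc : ∀ N f → gen (suc N) f ≈ ι (f 0) + ζ * gen N (f ∘ suc)
  gen-suc N f = eval-suc {N} (λ i → f (toℕ i))

  gen-linear : ∀ N a b f g → gen N (λ x → a ℤ.* f x ℤ.+ b ℤ.* g x) ≈ ι a * gen N f + ι b * gen N g
  gen-linear N a b f g = eval-linear {N} a b (λ i → f (toℕ i)) (λ i → g (toℕ i))

  gen-+ : ∀ N f g → gen N (λ x → f x ℤ.+ g x) ≈ gen N f + gen N g
  gen-+ N f g = trans (gen-cong N (λ x _ → lemma (f x) (g x))) (trans (gen-linear N (+ 1) (+ 1) f g)
    (solve 2 (λ a b → con (+ 1) :* a :+ con (+ 1) :* b := a :+ b) refl (gen N f) (gen N g)))
    where
    lemma : ∀ a b → a ℤ.+ b ≡ + 1 ℤ.* a ℤ.+ + 1 ℤ.* b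
    lemma = solve-∀

  gen-*ˡ : ∀ N a f → gen N (λ x → a ℤ.* f x) ≈ ι a * gen N f
  gen-*ˡ N a f = trans (gen-cong N (λ x _ → lemma (a ℤ.* f x) (f x))) (trans (gen-linear N a (+ 0) f f)
    (solve 2 (λ a b → a :* b :+ con (+ 0) :* b := a :* b) refl (ι a) (gen N f)))
    where
    lemma : ∀ b c → b ≡ b ℤ.+ + 0 ℤ.* c
    lemma = solve-∀

  gen-split : ∀ m n f → gen (m ℕ.+ n) f ≈ gen m f + ζ ^ m * gen n (λ x → f (m ℕ.+ x))
  gen-split m n f = trans (Σ<-+ m n (λ x → ι (f x) * ζ ^ x)) (+-congˡ (trans
    (sum-cong-≋ {n} (λ i → trans (*-congˡ (^-homo-* ζ m (toℕ i)))
      (solve 3 (λ a b c → a :* (b :* c) := b :* (a :* c)) refl (ι (f (m ℕ.+ toℕ i))) (ζ ^ m) (ζ ^ toℕ i))))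
    (sym (*-distribˡ-sum {n} (ζ ^ m) (λ i → ι (f (m ℕ.+ toℕ i)) * ζ ^ toℕ i)))))

  -- Each block of length n contributes ζ^a times a power of ζ^n, so this is a finite geometric
  -- series, kept in product form to avoid division.
  gen-class : ∀ {a n} → a < n → ∀ k →
    (1# - ζ ^ n) * gen (k ℕ.* n) (λ x → δ n (+ x) (+ a)) ≈ ζ ^ a * (1# - ζ ^ (k ℕ.* n))
  gen-class {a} {n} a<n zero = trans (zeroʳ _) (sym (trans (*-congˡ (-‿inverseʳ 1#)) (zeroʳ _)))
  gen-class {a} {n} a<n (suc k) = begin
    (1# - z) * gen (n ℕ.+ k ℕ.* n) g
      ≈⟨ *-congˡ (trans (gen-split n (k ℕ.* n) g) (+-cong block (*-congˡ
           (gen-cong (k ℕ.* n) (λ x _ → δ-congˡ n (+ (n ℕ.+ x)) (+ x) (+ a) (mod-shift n x)))))) ⟩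
    (1# - z) * (ζ ^ a + z * X)
      ≈⟨ solve 4 (λ o z a x → (o :- z) :* (a :+ z :* x) := (o :- z) :* a :+ z :* ((o :- z) :* x)) refl 1# z (ζ ^ a) X ⟩
    (1# - z) * ζ ^ a + z * ((1# - z) * X)
      ≈⟨ +-congˡ (*-congˡ (gen-class a<n k)) ⟩
    (1# - z) * ζ ^ a + z * (ζ ^ a * (1# - w))
      ≈⟨ solve 4 (λ o z a w → (o :- z) :* a :+ z :* (a :* (o :- w)) := a :* (o :+ (z :* o :- z) :- z :* w)) refl 1# z (ζ ^ a) w ⟩
    ζ ^ a * (1# + (z * 1# - z) - z * w)
      ≈⟨ *-congˡ (+-cong (trans (+-congˡ (x≈y⇒x∙y⁻¹≈ε (*-identityʳ z))) (+-identityʳ 1#)) (-‿cong (sym (^-homo-* ζ n (k ℕ.* n))))) ⟩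
    ζ ^ a * (1# - ζ ^ (n ℕ.+ k ℕ.* n)) ∎
    where
    z = ζ ^ n
    w = ζ ^ (k ℕ.* n)
    g : ℕ → ℤ
    g x = δ n (+ x) (+ a)
    X = gen (k ℕ.* n) g
    block : gen n g ≈ ζ ^ a
    block = trans (Σ<-single n (λ x → ι (g x) * ζ ^ x) a<n (λ x x<n x≢a → trans
        (*-congʳ (reflexive (≡.cong ι (𝟙-no (n ℕ.∣? ∣ + x ℤ.- + a ∣) (x≢a ∘ mod-<⇒≡ x<n a<n))))) (zeroˡ _)))
      (trans (*-congʳ (trans (reflexive (≡.cong ι (𝟙-yes (n ℕ.∣? ∣ + a ℤ.- + a ∣) (mod-refl {n} (+ a))))) ι-1)) (*-identityˡ _))

  gen-covering : ∀ {N} A → All (λ r → proj₁ r < proj₂ r) A → All (ℕ._∣ N) (moduli A) →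
    (∀ {n} → n ∈ moduli A → ¬ (p ℕ.∣ n)) → (1# - ζ ^ N) * cotSum F ζ A ≈ gen N (λ x → + covering A (+ x))
  gen-covering {N} [] _ _ _ = trans (zeroʳ _) (sym (sum-zero {N} (λ i → zeroˡ _)))
  gen-covering ((a , n) ∷ A) (a<n ∷ A<) (ℕ.divides k ≡.refl ∷ A∣N) p∤ = begin
    (1# - ζ ^ N) * (ζ ^ a * (1# - ζ ^ n) ⁻¹ + cotSum F ζ A)
      ≈⟨ solve 4 (λ d a i c → d :* (a :* i :+ c) := a :* d :* i :+ d :* c) refl (1# - ζ ^ N) (ζ ^ a) ((1# - ζ ^ n) ⁻¹) (cotSum F ζ A) ⟩
    ζ ^ a * (1# - ζ ^ N) * (1# - ζ ^ n) ⁻¹ + (1# - ζ ^ N) * cotSum F ζ A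
      ≈⟨ +-cong (*-congʳ (sym (gen-class a<n k))) (gen-covering A A< A∣N (p∤ ∘ there)) ⟩
    (1# - ζ ^ n) * X * (1# - ζ ^ n) ⁻¹ + gen N (λ x → + covering A (+ x))
      ≈⟨ +-congʳ (solve 3 (λ d x i → d :* x :* i := d :* i :* x) refl (1# - ζ ^ n) X ((1# - ζ ^ n) ⁻¹)) ⟩
    (1# - ζ ^ n) * (1# - ζ ^ n) ⁻¹ * X + gen N (λ x → + covering A (+ x))
      ≈⟨ +-congʳ (trans (*-congʳ (inverseʳ _ (1-ζ^≉0 (p∤ (here ≡.refl))))) (*-identityˡ X)) ⟩
    X + gen N (λ x → + covering A (+ x))
      ≈⟨ gen-+ N (λ x → δ n (+ x) (+ a)) (λ x → + covering A (+ x)) ⟨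
    gen N (λ x → δ n (+ x) (+ a) ℤ.+ + covering A (+ x))
      ≈⟨ gen-cong N (λ x _ → covering-∷ a n A (+ x)) ⟨
    gen N (λ x → + covering ((a , n) ∷ A) (+ x)) ∎
    where
    N = k ℕ.* n
    X = gen N (λ x → δ n (+ x) (+ a))

  module _ {N} (f : ℕ → ℤ) (periodic : ∀ x → f (N ℕ.+ x) ≡ f x) (Φ₀≈0 : gen N f ≈ 0#) where

    Φ : ℕ → Carrier
    Φ j = gen N (λ x → f (x ℕ.+ j))

    -- The power series Σ f(x) zˣ equals Φ 0 / (1 - z ^ N), so its truncations are given by the Φ M.
    truncation : ∀ M → (1# - ζ ^ N) * gen M f + ζ ^ M * Φ M ≈ 0#
    truncation M = begin
      (1# - ζ ^ N) * gen M f + ζ ^ M * Φ M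
        ≈⟨ +-cong (solve 3 (λ o z g → (o :- z) :* g := o :* g :- z :* g) refl 1# (ζ ^ N) (gen M f))
             (*-congˡ (gen-cong N (λ x _ → ≡.cong f (ℕ.+-comm x M)))) ⟩
      1# * gen M f - ζ ^ N * gen M f + ζ ^ M * gen N (λ x → f (M ℕ.+ x))
        ≈⟨ solve 3 (λ a b c → a :- b :+ c := a :+ c :- b) refl (1# * gen M f) (ζ ^ N * gen M f) (ζ ^ M * gen N (λ x → f (M ℕ.+ x))) ⟩
      1# * gen M f + ζ ^ M * gen N (λ x → f (M ℕ.+ x)) - ζ ^ N * gen M f
        ≈⟨ +-cong (trans (+-congʳ (*-identityˡ _)) (sym (gen-split M N f))) (-‿cong (*-congˡ (gen-cong M (λ x _ → ≡.sym (periodic x))))) ⟩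
      gen (M ℕ.+ N) f - ζ ^ N * gen M (λ x → f (N ℕ.+ x))
        ≡⟨ ≡.cong (λ k → gen k f - ζ ^ N * gen M (λ x → f (N ℕ.+ x))) (ℕ.+-comm M N) ⟩
      gen (N ℕ.+ M) f - ζ ^ N * gen M (λ x → f (N ℕ.+ x))
        ≈⟨ +-congʳ (trans (gen-split N M f) (+-congʳ Φ₀≈0)) ⟩
      0# + ζ ^ N * gen M (λ x → f (N ℕ.+ x)) - ζ ^ N * gen M (λ x → f (N ℕ.+ x))
        ≈⟨ solve 1 (λ a → con (+ 0) :+ a :- a := con (+ 0)) refl (ζ ^ N * gen M (λ x → f (N ℕ.+ x))) ⟩
      0# ∎

    -- Induction along d = d 0 + z d′: the constant term is handled by `truncation`, and z turns
    -- into ζ. When f satisfies the recurrence, the second summand vanishes, leaving 1 - ζ^N times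
    -- the truncated product.
    ⊛-truncation : ∀ M d → (1# - ζ ^ N) * gen M (d ⊛ f) + ζ ^ M * gen N (recurrence d f M) ≈ 0#
    ⊛-truncation zero d = begin
      (1# - ζ ^ N) * 0# + 1# * gen N (recurrence d f 0)
        ≈⟨ +-cong (zeroʳ _) (*-congˡ (trans (gen-cong N (λ x _ → ≡.trans (ℤ.+-identityʳ _)
             (≡.cong (λ y → d 0 ℤ.* f y) (ℕ.+-identityʳ x)))) (gen-*ˡ N (d 0) f))) ⟩
      0# + 1# * (ι (d 0) * gen N f)
        ≈⟨ +-congˡ (*-congˡ (*-congˡ Φ₀≈0)) ⟩
      0# + 1# * (ι (d 0) * 0#)
        ≈⟨ solve 2 (λ o d → con (+ 0) :+ o :* (d :* con (+ 0)) := con (+ 0)) refl 1# (ι (d 0)) ⟩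
      0# ∎
    ⊛-truncation (suc M) d = begin
      D * gen (suc M) (d ⊛ f) + ζ ^ suc M * gen N (recurrence d f (suc M))
        ≈⟨ +-cong (*-congˡ low) (*-congˡ high) ⟩
      D * (ι (d 0) * gen (suc M) f + ζ * gen M (d′ ⊛ f)) + ζ * ζ ^ M * (ι (d 0) * Φ (suc M) + gen N (recurrence d′ f M))
        ≈⟨ solve 8 (λ D d T z G w Ph R → D :* (d :* T :+ z :* G) :+ z :* w :* (d :* Ph :+ R) :=
             d :* (D :* T :+ z :* w :* Ph) :+ z :* (D :* G :+ w :* R)) refl
             D (ι (d 0)) (gen (suc M) f) ζ (gen M (d′ ⊛ f)) (ζ ^ M) (Φ (suc M)) (gen N (recurrence d′ f M)) ⟩
      ι (d 0) * (D * gen (suc M) f + ζ ^ suc M * Φ (suc M)) + ζ * (D * gen M (d′ ⊛ f) + ζ ^ M * gen N (recurrence d′ f M))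
        ≈⟨ +-cong (*-congˡ (truncation (suc M))) (*-congˡ (⊛-truncation M d′)) ⟩
      ι (d 0) * 0# + ζ * 0#
        ≈⟨ solve 2 (λ a b → a :* con (+ 0) :+ b :* con (+ 0) := con (+ 0)) refl (ι (d 0)) ζ ⟩
      0# ∎
      where
      D = 1# - ζ ^ N
      d′ = d ∘ suc
      high : gen N (recurrence d f (suc M)) ≈ ι (d 0) * Φ (suc M) + gen N (recurrence d′ f M)
      high = trans (gen-+ N (λ x → d 0 ℤ.* f (x ℕ.+ suc M)) (recurrence d′ f M)) (+-congʳ (gen-*ˡ N (d 0) (λ x → f (x ℕ.+ suc M))))
      low : gen (suc M) (d ⊛ f) ≈ ι (d 0) * gen (suc M) f + ζ * gen M (d′ ⊛ f)
      low = begin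
        gen (suc M) (d ⊛ f)
          ≈⟨ gen-suc M (d ⊛ f) ⟩
        ι (d 0 ℤ.* f 0) + ζ * gen M (λ x → d 0 ℤ.* f (suc x) ℤ.+ (d′ ⊛ f) x)
          ≈⟨ +-cong (ι-* (d 0) (f 0)) (*-congˡ (trans (gen-+ M (λ x → d 0 ℤ.* f (suc x)) (d′ ⊛ f)) (+-congʳ (gen-*ˡ M (d 0) (f ∘ suc))))) ⟩
        ι (d 0) * ι (f 0) + ζ * (ι (d 0) * gen M (f ∘ suc) + gen M (d′ ⊛ f))
          ≈⟨ solve 5 (λ d f z a b → d :* f :+ z :* (d :* a :+ b) := d :* (f :+ z :* a) :+ z :* b) refl
               (ι (d 0)) (ι (f 0)) ζ (gen M (f ∘ suc)) (gen M (d′ ⊛ f)) ⟩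
        ι (d 0) * (ι (f 0) + ζ * gen M (f ∘ suc)) + ζ * gen M (d′ ⊛ f)
          ≈⟨ +-congʳ (*-congˡ (gen-suc M f)) ⟨
        ι (d 0) * gen (suc M) f + ζ * gen M (d′ ⊛ f) ∎

    -- The number p - 1 = `suc q` plays two parts that have to match: it bounds the degree of d, and
    -- so it is also the number of coefficients of d f not covered by the recurrence. That many
    -- powers of ζ are independent.
    recurrence⇒≡0 : ¬ (p ℕ.∣ N) → ∀ d → (∀ i → suc q < i → d i ≡ + 0) → (∃ λ j → d j ≢ + 0) →
      (∀ x → recurrence d f (suc q) x ≡ + 0) → ∀ x → f x ≡ + 0
    recurrence⇒≡0 p∤N d d≡0 (j , dj≢0) rec≡0 = ⊛≡0⇒≡0 j d f dj≢0 product≡0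
      where
      M = suc q
      gen≈0 : gen M (d ⊛ f) ≈ 0#
      gen≈0 = x*y≈0⇒y≈0 (1-ζ^≉0 p∤N) (begin
        (1# - ζ ^ N) * gen M (d ⊛ f)
          ≈⟨ +-identityʳ _ ⟨
        (1# - ζ ^ N) * gen M (d ⊛ f) + 0#
          ≈⟨ +-congˡ (trans (*-congˡ (sum-zero {N} (λ i → trans (*-congʳ (reflexive (≡.cong ι (rec≡0 (toℕ i))))) (zeroˡ _)))) (zeroʳ _)) ⟨
        (1# - ζ ^ N) * gen M (d ⊛ f) + ζ ^ M * gen N (recurrence d f M)
          ≈⟨ ⊛-truncation M d ⟩
        0# ∎)
      product≡0 : ∀ m → (d ⊛ f) m ≡ + 0
      product≡0 m with ℕ.<-≤-connex m M
      ... | Data.Sum.inj₁ m<M = ≡.subst (λ m → (d ⊛ f) m ≡ + 0) (Fin.toℕ-fromℕ< m<M)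
              (linearly-independent ℕ.≤-refl (λ i → (d ⊛ f) (toℕ i)) gen≈0 (fromℕ< m<M))
      ... | Data.Sum.inj₂ M≤m = ≡.subst (λ m → (d ⊛ f) m ≡ + 0) (ℕ.m+[n∸m]≡n M≤m)
              (≡.trans (⊛-recurrence d f M (m ∸ M) d≡0) (rec≡0 (m ∸ M)))

-- The equivalence of the two conditions

prime∤product : ∀ {p} → Prime p → ∀ ns → (∀ {n} → n ∈ ns → ¬ (p ℕ.∣ n)) → ¬ (p ℕ.∣ product ns)
prime∤product pp []       _  = prime∤! pp 0 (ℕ.>-nonZero⁻¹ _ {{prime⇒nonZero pp}})
prime∤product pp (n ∷ ns) p∤ =
  [ p∤ (here ≡.refl) , prime∤product pp ns (p∤ ∘ there) ]′ ∘ euclidsLemma n (product ns) pp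

theorem1p1 : ∀ {c ℓ} (F : Field c ℓ) → CharZero F →
    (A B : System) →
    All (λ r → proj₁ r < proj₂ r) A →
    All (λ r → proj₁ r < proj₂ r) B →
    (p : ℕ) → Prime p → cardS A B < p →
    (ζ : Field.Carrier F) → PrimitiveRoot F p ζ →
    CoveringEquivalent A B ⇔ Field._≈_ F (cotSum F ζ A) (cotSum F ζ B)
theorem1p1 F char0 A B A< B< zero          p-prime = ⊥-elim (¬prime[0] p-prime)
theorem1p1 F char0 A B A< B< (suc zero)    p-prime = ⊥-elim (¬prime[1] p-prime)
theorem1p1 F char0 A B A< B< (suc (suc q)) p-prime card<p ζ ζ-prim = mk⇔ equivalent⇒≈ ≈⇒equivalent
  where
  open Field F hiding (zero)
  open FieldLemmas F char0
  open GeneratingFunctions F char0 p-prime ζ-prim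
  open import Relation.Binary.Reasoning.Setoid setoid
  open Solver using (solve; _:=_; _:+_; _:*_; con)
  p = suc (suc q)
  ns = moduli A ++ moduli B
  N = product ns

  moduli-nonZero : ∀ {C} → All (λ r → proj₁ r < proj₂ r) C → All ℕ.NonZero (moduli C)
  moduli-nonZero C< = All.map⁺ (All.map (λ a<n → ℕ.>-nonZero (ℕ.≤-<-trans z≤n a<n)) C<)
  ns-nonZero : All ℕ.NonZero ns
  ns-nonZero = All.++⁺ (moduli-nonZero A<) (moduli-nonZero B<)
  instance
    N-nonZero : ℕ.NonZero N
    N-nonZero = product≢0 ns-nonZero

  ns∣N : All (ℕ._∣ N) ns
  ns∣N = All.tabulate ∈⇒∣product
  A∣N : All (ℕ._∣ N) (moduli A)
  A∣N = All.++⁻ˡ (moduli A) ns∣N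
  B∣N : All (ℕ._∣ N) (moduli B)
  B∣N = All.++⁻ʳ (moduli A) ns∣N
  p∤ns : ∀ {n} → n ∈ ns → ¬ (p ℕ.∣ n)
  p∤ns n∈ p∣n = ℕ.<⇒≱ card<p (ℕ.≤-trans (ℕ.∣⇒≤ {{All.lookup ns-nonZero n∈}} p∣n) (modulus≤ n∈))
  p∤N : ¬ (p ℕ.∣ N)
  p∤N = prime∤product p-prime ns p∤ns

  genA : (1# - ζ ^ N) * cotSum F ζ A ≈ gen N (λ x → + covering A (+ x))
  genA = gen-covering A A< A∣N (p∤ns ∘ ∈-++⁺ˡ)
  genB : (1# - ζ ^ N) * cotSum F ζ B ≈ gen N (λ x → + covering B (+ x))
  genB = gen-covering B B< B∣N (p∤ns ∘ ∈-++⁺ʳ (moduli A))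

  equivalent⇒≈ : CoveringEquivalent A B → cotSum F ζ A ≈ cotSum F ζ B
  equivalent⇒≈ equiv = *-cancelˡ-≉0 (1-ζ^≉0 p∤N)
    (trans genA (trans (gen-cong N (λ x _ → ≡.cong +_ (equiv (+ x)))) (sym genB)))

  -- The difference is spelled as a linear combination to match `Fixes-linear` and `gen-linear`
  -- literally.
  f : ℕ → ℤ
  f x = + 1 ℤ.* + covering A (+ x) ℤ.+ (ℤ.- + 1) ℤ.* + covering B (+ x)

  f-cong : ∀ x y → + x ≡ + y mod N → f x ≡ f y
  f-cong x y x≡y = ≡.cong₂ (λ a b → + 1 ℤ.* a ℤ.+ (ℤ.- + 1) ℤ.* b)
    (covering-periodic A A∣N (+ x) (+ y) x≡y) (covering-periodic B B∣N (+ x) (+ y) x≡y)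

  open PeriodicProjection ns∣N using (projection; isScaledProjection)

  -- The shifts run downwards from p - 1 to 0, so that a dependence among them is a `recurrence`
  -- with the same coefficients in the same order.
  shifts : Fin p → Fin N → ℤ
  shifts m i = f (toℕ i ℕ.+ (suc q ∸ toℕ m))

  shifts-dependent : Dependent shifts
  shifts-dependent = dependence-bound N shifts isScaledProjection
    (λ m → Fixes-linear projection {+ N} (+ 1) (ℤ.- + 1)
      {λ i → + covering A (+ (toℕ i ℕ.+ (suc q ∸ toℕ m)))} {λ i → + covering B (+ (toℕ i ℕ.+ (suc q ∸ toℕ m)))}
      (covering-fixed ns∣N A ∈-++⁺ˡ (suc q ∸ toℕ m)) (covering-fixed ns∣N B (∈-++⁺ʳ (moduli A)) (suc q ∸ toℕ m)))
    (ℤ.≤-<-trans (rank≤ ns∣N) (ℤ.+<+ card<p))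

  d : ℕ → ℤ
  d = extend (proj₁ shifts-dependent)

  -- The dependence is known for x < N only; the period N of f carries it to all x.
  recurrence≡0 : ∀ x → recurrence d f (suc q) x ≡ + 0
  recurrence≡0 x = ≡.trans
    (ℤ-Sum.sum-cong-≋ {p} (λ m → ≡.cong₂ ℤ._*_ (extend-toℕ (proj₁ shifts-dependent) m)
      (f-cong (x ℕ.+ (suc q ∸ toℕ m)) (toℕ i ℕ.+ (suc q ∸ toℕ m)) (mod-+ʳ x (toℕ i) (suc q ∸ toℕ m) x≡i))))
    (proj₂ (proj₂ shifts-dependent) i)
    where
    i : Fin N
    i = fromℕ< (ℤ.n%ℕd<d (+ x) N)
    x≡i : + x ≡ + toℕ i mod N
    x≡i = ≡.subst (λ r → + x ≡ + r mod N) (≡.sym (Fin.toℕ-fromℕ< (ℤ.n%ℕd<d (+ x) N))) (mod-residue (+ x) N)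

  ≈⇒equivalent : cotSum F ζ A ≈ cotSum F ζ B → CoveringEquivalent A B
  ≈⇒equivalent cot≈ x = ℤ.+-injective covering≡
    where
    Φ₀≈0 : gen N f ≈ 0#
    Φ₀≈0 = begin
      gen N f
        ≈⟨ gen-linear N (+ 1) (ℤ.- + 1) (λ x → + covering A (+ x)) (λ x → + covering B (+ x)) ⟩
      ι (+ 1) * gen N (λ x → + covering A (+ x)) + ι (ℤ.- + 1) * gen N (λ x → + covering B (+ x))
        ≈⟨ +-congʳ (*-congˡ (trans (sym genA) (trans (*-congˡ cot≈) genB))) ⟩
      ι (+ 1) * gen N (λ x → + covering B (+ x)) + ι (ℤ.- + 1) * gen N (λ x → + covering B (+ x))
        ≈⟨ solve 1 (λ b → con (+ 1) :* b :+ con (ℤ.- + 1) :* b := con (+ 0)) refl (gen N (λ x → + covering B (+ x))) ⟩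
      0# ∎
    f≡0 : ∀ x → f x ≡ + 0
    f≡0 = recurrence⇒≡0 f (λ x → f-cong (N ℕ.+ x) x (mod-shift N x)) Φ₀≈0 p∤N d
      (λ i p≤i → extend-≥ (proj₁ shifts-dependent) i p≤i)
      (toℕ (proj₁ (proj₁ (proj₂ shifts-dependent))) , λ d≡0 → proj₂ (proj₁ (proj₂ shifts-dependent))
        (≡.trans (≡.sym (extend-toℕ (proj₁ shifts-dependent) _)) d≡0))
      recurrence≡0
    difference : ∀ a b → a ≡ + 1 ℤ.* a ℤ.+ (ℤ.- + 1) ℤ.* b ℤ.+ b
    difference = solve-∀
    -- f is defined on ℕ, so negative x are reached through their residue modulo N.
    r : ℕ
    r = x ℤ.%ℕ N
    x≡r : x ≡ + r mod N
    x≡r = mod-residue x N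
    covering≡ : + covering A x ≡ + covering B x
    covering≡ = ≡.trans (covering-periodic A A∣N x (+ r) x≡r) (≡.trans
      (≡.trans (difference (+ covering A (+ r)) (+ covering B (+ r)))
        (≡.trans (≡.cong (ℤ._+ + covering B (+ r)) (f≡0 r)) (ℤ.+-identityˡ _)))
      (≡.sym (covering-periodic B B∣N x (+ r) x≡r)))
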